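{- Let $w_n$ be the number of weak-ordering chains in $\mathcal{WOC}(n)$ subject to the stopping condition $x_{i_1}\le x_{i_2}\le x_{i_3}$ with $i_1<i_2<i_3$. Then \[ w_n=\sum_{d=0}^{n-1}2^{n-1-d}e_{n,d}+\sum_{j=3}^{n}\sum_{d=0}^{j-3}2^{j-1-d}g_{j,d}. \] The sequence starts $1,3,13,59,269,1227,5613,25771,118765,\dots$, and $W(x)=\sum_{n\ge1}w_nx^n$ satisfies \[ 1+W(x)=\frac{x}{1-x^2}+\frac{1-2x-2x^2}{(1-x^2)\sqrt{1-4x-4x^2}}. \]
   Context: A weak-ordering chain on $x_1,\dots,x_m$ is an expression $x_{i_1}\,\mathrm{op}\,x_{i_2}\,\mathrm{op}\cdots\mathrm{op}\,x_{i_m}$, where $(i_1,\dots,i_m)$ is an ordering of $[m]$ and each $\mathrm{op}$ is $<$ or $=$; expressions defining the same ordered set partition of $[m]$ are identified. $\mathcal{WOC}(m)$ is the set of these chains. Each chain in $\mathcal{WOC}(m)$, $m\ge 2$, arises uniquely from its restriction to $x_1,\dots,x_{m-1}$ by inserting $x_m$; this gives a rooted tree with root $x_1$ whose level-$m$ nodes are the elements of $\mathcal{WOC}(m)$. The restricted generating tree of order $n$ for a stopping condition is the part of this tree up to level $n$ in which any node containing the stopping condition has no descendants; "the number of weak-ordering chains in $\mathcal{WOC}(n)$ subject to the stopping condition" is the number of leaves of this tree (nodes at level $n$ plus nodes containing the condition), equivalently the number of chains in $\mathcal{WOC}(n)$ avoiding the condition plus, for each $j\le n$, the number of chains in $\mathcal{WOC}(j)$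 containing the condition whose restriction to $x_1,\dots,x_{j-1}$ avoids it. Here a chain contains the stopping condition if there are indices $i_1<i_2<i_3$ such that $x_{i_1}\le x_{i_2}$ and $x_{i_2}\le x_{i_3}$ hold in the chain (each relation being $<$ or $=$). $e_{n,d}$ is the number of $123$-avoiding permutations of $[n]$ with exactly $d$ descents. $g_{j,d}=|\mathcal{G}^d_j(123)|$, where for $j>3$, $1\le d\le j-3$, $\mathcal{G}^d_j(123)$ is the set of permutations $\sigma$ of $[j]$ that contain the pattern $123$, have exactly $d$ descents, and such that the permutation obtained from $\sigma$ by deleting $j$ avoids $123$; $\mathcal{G}^0_3(123)=\{123\}$, and $g_{j,d}=0$ otherwise. -}

module Defs where

open import Data.Nat using (ℕ; zero; suc; _+_; _*_; _∸_; _^_; _<ᵇ_; _≡ᵇ_)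
open import Data.Bool using (Bool; true; false; _∧_; _∨_; not; if_then_else_)
open import Data.List using (List; []; _∷_; map; _++_; filter; length; upTo; concatMap)
open import Data.Nat.ListAction using (sum)
open import Data.Bool.ListAction using (all; any)
open import Data.Product using (_×_; _,_)
open import Data.Integer as ℤ using (ℤ)
open import Relation.Nullary.Decidable using (T?)
open import Data.Bool using (T)

words : ℕ → ℕ → List (List ℕ)
words zero    k = [] ∷ []
words (suc m) k = concatMap (λ v → map (v ∷_) (words m k)) (upTo k)

elemᵇ : ℕ → List ℕ → Bool
elemᵇ v []      = false
elemᵇ v (x ∷ l) = (v ≡ᵇ x) ∨ elemᵇ v l

count : {A : Set} → (A → Bool) → List A → ℕ
count p l = length (filter (λ x → T? (p x)) l)

pairs : List ℕ → List (ℕ × ℕ)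
pairs []      = []
pairs (a ∷ l) = map (a ,_) l ++ pairs l

triples : List ℕ → List (ℕ × ℕ × ℕ)
triples []      = []
triples (a ∷ l) = map (λ { (b , c) → (a , b , c) }) (pairs l) ++ triples l

init : List ℕ → List ℕ
init []          = []
init (a ∷ [])    = []
init (a ∷ b ∷ l) = a ∷ init (b ∷ l)

_≤ᵇ'_ : ℕ → ℕ → Bool
a ≤ᵇ' b = (a <ᵇ b) ∨ (a ≡ᵇ b)

-- Weak-ordering chains.
-- A chain on x₁,…,x_m (an ordered set partition of [m]) is encoded by its
-- rank list (r₁,…,r_m): r_i is the index of the block containing x_i, so
-- x_i < x_j iff r_i < r_j and x_i = x_j iff r_i = r_j.  Rank lists are
-- exactly lists of length m whose set of values is an initial segment
-- {0,…,k-1} of ℕ (this makes the encoding a bijection).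

isRankList : ℕ → List ℕ → Bool
isRankList m l = all (λ v → not (elemᵇ (suc v) l) ∨ elemᵇ v l) (upTo m)

WOC : ℕ → List (List ℕ)
WOC m = filter (λ l → T? (isRankList m l)) (words m m)

containsStop : List ℕ → Bool
containsStop l = any (λ { (a , b , c) → (a ≤ᵇ' b) ∧ (b ≤ᵇ' c) }) (triples l)

-- restriction of a chain in WOC(j) to x₁,…,x_{j-1}: drop the last rank.
-- (The result may not be normalised to an initial segment of ranks, but
-- it describes the same relations, which is all containsStop looks at.)
restrict : List ℕ → List ℕ
restrict = init

-- number of leaves of the restricted generating tree of order n
w : ℕ → ℕ
w n = count (λ l → not (containsStop l)) (WOC n)
    + sum (map (λ j → count (λ l → containsStop l ∧ not (containsStop (restrict l))) (WOC j))
               (map suc (upTo n)))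

-- Permutations of [n], encoded as lists (σ(1),…,σ(n)) of values in
-- {0,…,n-1} (value v stands for v+1).

distinct : List ℕ → Bool
distinct []      = true
distinct (a ∷ l) = not (elemᵇ a l) ∧ distinct l

Perms : ℕ → List (List ℕ)
Perms n = filter (λ l → T? (distinct l)) (words n n)

contains123 : List ℕ → Bool
contains123 l = any (λ { (a , b , c) → (a <ᵇ b) ∧ (b <ᵇ c) }) (triples l)

descents : List ℕ → ℕ
descents l = count (λ { (a , b) → b <ᵇ a }) (adj l)
  where
  adj : List ℕ → List (ℕ × ℕ)
  adj []          = []
  adj (a ∷ [])    = []
  adj (a ∷ b ∷ l) = (a , b) ∷ adj (b ∷ l)

deleteMax : ℕ → List ℕ → List ℕ
deleteMax j l = filter (λ x → T? (not (x ≡ᵇ (j ∸ 1)))) l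

e : ℕ → ℕ → ℕ
e n d = count (λ σ → not (contains123 σ) ∧ (descents σ ≡ᵇ d)) (Perms n)

gCount : ℕ → ℕ → ℕ
gCount j d = count (λ σ → contains123 σ ∧ (descents σ ≡ᵇ d)
                          ∧ not (contains123 (deleteMax j σ))) (Perms j)

g : ℕ → ℕ → ℕ
g j d = if (j ≡ᵇ 3) ∧ (d ≡ᵇ 0) then 1
        else if (3 <ᵇ j) ∧ (0 <ᵇ d) ∧ ((d + 3) ≤ᵇ' j) then gCount j d
        else 0

rhs : ℕ → ℕ
rhs n = sum (map (λ d → 2 ^ (n ∸ 1 ∸ d) * e n d) (upTo n))
      + sum (map (λ j → sum (map (λ d → 2 ^ (j ∸ 1 ∸ d) * g j d) (upTo (j ∸ 2))))
                 (map (3 +_) (upTo (n ∸ 2))))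

Series : Set
Series = ℕ → ℤ

_⊕_ : Series → Series → Series
(f ⊕ h) n = f n ℤ.+ h n

_⊖_ : Series → Series → Series
(f ⊖ h) n = f n ℤ.- h n

_⊛_ : Series → Series → Series
(f ⊛ h) n = sum' (map (λ k → f k ℤ.* h (n ∸ k)) (upTo (suc n)))
  where
  sum' : List ℤ → ℤ
  sum' []      = ℤ.0ℤ
  sum' (a ∷ l) = a ℤ.+ sum' l

poly : List ℤ → Series
poly []      n       = ℤ.0ℤ
poly (c ∷ l) zero    = c
poly (c ∷ l) (suc n) = poly l n

Wser : Series
Wser zero    = ℤ.0ℤ
Wser (suc n) = ℤ.+ (w (suc n))

-- Both sides of the identity satisfy the recurrence f (n+1) = f n + J n 0 0, where J n 0 0 is
-- twice the number of blocks in all avoiding chains of length n: a chain with k blocks has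
-- 2k + 1 children, and the children that do not survive as avoiders are leaves.
-- Whether a child of an avoiding chain avoids depends only on the number h of blocks below
-- the lowest top of a weak ascent; the surviving children have labels h+1, 1, …, h (new block)
-- and 0, …, h-1 (old block). Listing the variables of a chain block by block, increasingly
-- within blocks, gives a permutation with a choice of < or = at each ascent, and the same
-- weights come out of inserting the maximum into 123-avoiding permutations weighted by 2^asc.
-- The generating function of J is solved by the kernel method: with C = 1 + (x + x²) C² and
-- U = (1 + x) C, a node of label h contributes C U^h, and differentiating in a variable
-- marking blocks brings in D with D (1 - 2xU) = xUC; then 1 - 2xU = √(1 - 4x - 4x²).
module Submission where

open import Algebra.Bundles using (CommutativeRing; RawRing)
import Algebra.Properties.CommutativeSemigroup as CommutativeSemigroup
import Algebra.Solver.Ring as RingSolver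
open import Algebra.Solver.Ring.AlmostCommutativeRing using (fromCommutativeRing; _-Raw-AlmostCommutative⟶_)
open import Data.Bool using (Bool; true; false; _∧_; _∨_; not; if_then_else_; T)
open import Data.Bool.ListAction using (all; any)
open import Data.Bool.Properties using (T-≡; ∨-assoc; ∨-comm; ∨-identityʳ; ∧-zeroʳ; ∧-identityʳ; ∨-zeroʳ)
open import Data.Empty using (⊥; ⊥-elim)
open import Data.List using (List; []; _∷_; map; _++_; length; upTo; concatMap; applyUpTo; _∷ʳ_; foldr; take; initLast; _∷ʳ′_)
open import Data.List.Membership.Propositional using (_∈_; _∉_; find; lose)
open import Data.List.Membership.Propositional.Properties
open import Data.List.Properties using (map-∘; map-++; map-upTo; map-id-local; length-map; length-upTo; length-++; ∷ʳ-injective; ∷-injectiveˡ; ∷-injectiveʳ)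
open import Data.List.Relation.Binary.Permutation.Propositional using (_↭_; prep; swap; ↭-refl; ↭-sym; ↭-trans; ↭⇒↭ₛ)
import Data.List.Relation.Binary.Permutation.Propositional.Properties as ↭
import Data.List.Relation.Binary.Permutation.Setoid.Properties as ↭ₛ
open import Data.List.Relation.Binary.Subset.Propositional using (_⊆_)
open import Data.List.Relation.Unary.All as All using (All; []; _∷_)
open import Data.List.Relation.Unary.AllPairs using ([]; _∷_)
open import Data.List.Relation.Unary.Any using (here; there)
open import Data.List.Relation.Unary.Unique.Propositional using (Unique)
open import Data.List.Relation.Unary.Unique.Propositional.Properties using (Unique[x∷xs]⇒x∉xs; ++⁺; map⁺; upTo⁺; filter⁺; applyUpTo⁺₁)
open import Data.Maybe using (Maybe; just; nothing)
open import Data.Nat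
open import Data.Nat.ListAction using (sum)
open import Data.Nat.ListAction.Properties using (sum-++; sum-↭)
open import Data.Nat.Properties
open import Data.Nat.Solver using (module +-*-Solver)
open import Data.List.Membership.DecPropositional _≟_ using (_∈?_)
open import Data.Product using (_×_; _,_; proj₁; proj₂; ∃; Σ)
open import Data.Sum using (_⊎_; inj₁; inj₂)
open import Defs
open import Function using (_∘_; id)
open import Function.Bundles using (Equivalence)
open import Level using (0ℓ)
open import Relation.Binary.PropositionalEquality hiding (J; [_])
open import Relation.Nullary using (¬_; yes; no)
open import Relation.Nullary.Decidable using (T?)

open CommutativeSemigroup +-commutativeSemigroup using () renaming (interchange to +-interchange)

-- Sending a chain to its listing and its signs would be a bijection between the two sides, but it
-- is never constructed: each side is shown to obey the same recurrence inside its own insertion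
-- tree. These trees do not match node by node. A permutation with a ascents stands for 2^a chains
-- with different labels and numbers of blocks, so no single value of `J` describes it; what
-- survives insertion is that its weighted descendant sum is 2^a times the mean of two values of `J`
-- at adjacent labels. The mean number of blocks, (n + d + 1) / 2 for d descents, can be a
-- half-integer. Hence `J` carries the doubled number, takes odd arguments too, and is used through
-- its affine dependence on that argument. On the analytic side the sum over smaller labels in the
-- recursion of `J` disappears when consecutive labels are subtracted. What remains has coefficients
-- independent of the label, which is why powers U^h solve it.

Σ[_] : {α : Set} → List α → (α → ℕ) → ℕ
Σ[ l ] f = sum (map f l)

Σ< : ℕ → (ℕ → ℕ) → ℕ
Σ< zero    f = 0
Σ< (suc n) f = f 0 + Σ< n (f ∘ suc)

-- Finite sums over lists and over initial segments

private variable α β : Set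

Σ-cong : {f g : α → ℕ} (l : List α) → (∀ x → x ∈ l → f x ≡ g x) → Σ[ l ] f ≡ Σ[ l ] g
Σ-cong []      eq = refl
Σ-cong (x ∷ l) eq = cong₂ _+_ (eq x (here refl)) (Σ-cong l (λ y → eq y ∘ there))

Σ-map : (h : α → β) (l : List α) {f : β → ℕ} → Σ[ map h l ] f ≡ Σ[ l ] (f ∘ h)
Σ-map h l = cong sum (sym (map-∘ l))

Σ-++ : (l m : List α) {f : α → ℕ} → Σ[ l ++ m ] f ≡ Σ[ l ] f + Σ[ m ] f
Σ-++ l m {f} = trans (cong sum (map-++ f l m)) (sum-++ (map f l) (map f m))

Σ-concatMap : (h : α → List β) (l : List α) {f : β → ℕ} →
              Σ[ concatMap h l ] f ≡ Σ[ l ] (λ x → Σ[ h x ] f)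
Σ-concatMap h []      = refl
Σ-concatMap h (x ∷ l) = trans (Σ-++ (h x) (concatMap h l)) (cong (_ +_) (Σ-concatMap h l))

Σ-↭ : {l m : List α} {f : α → ℕ} → l ↭ m → Σ[ l ] f ≡ Σ[ m ] f
Σ-↭ {f = f} p = sum-↭ (↭.map⁺ f p)

Σ-+ : {f g : α → ℕ} (l : List α) → Σ[ l ] (λ x → f x + g x) ≡ Σ[ l ] f + Σ[ l ] g
Σ-+ []                = refl
Σ-+ {f = f} {g} (x ∷ l) = trans (cong (f x + g x +_) (Σ-+ l)) (+-interchange (f x) (g x) _ _)

Σ-* : {f : α → ℕ} (c : ℕ) (l : List α) → Σ[ l ] (λ x → c * f x) ≡ c * Σ[ l ] f
Σ-* c []              = sym (*-zeroʳ c)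
Σ-* {f = f} c (x ∷ l) = trans (cong (c * f x +_) (Σ-* c l)) (sym (*-distribˡ-+ c (f x) _))

Σ-0 : (l : List α) → Σ[ l ] (λ _ → 0) ≡ 0
Σ-0 []      = refl
Σ-0 (_ ∷ l) = Σ-0 l

Σ-swap : (l : List α) (m : List β) {f : α → β → ℕ} →
         Σ[ l ] (λ x → Σ[ m ] (f x)) ≡ Σ[ m ] (λ y → Σ[ l ] (λ x → f x y))
Σ-swap []      m         = sym (Σ-0 m)
Σ-swap (x ∷ l) m {f = f} = trans (cong (Σ[ m ] (f x) +_) (Σ-swap l m)) (sym (Σ-+ m))

Σ-applyUpTo : ∀ n (h : ℕ → α) {f : α → ℕ} → Σ[ applyUpTo h n ] f ≡ Σ< n (f ∘ h)
Σ-applyUpTo zero    h = refl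
Σ-applyUpTo (suc n) h = cong (_ +_) (Σ-applyUpTo n (h ∘ suc))

Σ-upTo : ∀ n {f : ℕ → ℕ} → Σ[ upTo n ] f ≡ Σ< n f
Σ-upTo n = Σ-applyUpTo n id

Σ<-cong : ∀ n {f g : ℕ → ℕ} → (∀ i → i < n → f i ≡ g i) → Σ< n f ≡ Σ< n g
Σ<-cong zero    eq = refl
Σ<-cong (suc n) eq = cong₂ _+_ (eq 0 z<s) (Σ<-cong n (λ i i<n → eq (suc i) (s<s i<n)))

Σ<-0 : ∀ n → Σ< n (λ _ → 0) ≡ 0
Σ<-0 zero    = refl
Σ<-0 (suc n) = Σ<-0 n

Σ<-const : ∀ n c → Σ< n (λ _ → c) ≡ n * c
Σ<-const zero    c = refl
Σ<-const (suc n) c = cong (c +_) (Σ<-const n c)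

Σ<-+ : ∀ n {f g : ℕ → ℕ} → Σ< n (λ i → f i + g i) ≡ Σ< n f + Σ< n g
Σ<-+ zero            = refl
Σ<-+ (suc n) {f} {g} = trans (cong (f 0 + g 0 +_) (Σ<-+ n)) (+-interchange (f 0) (g 0) _ _)

Σ<-* : ∀ c n {f : ℕ → ℕ} → Σ< n (λ i → c * f i) ≡ c * Σ< n f
Σ<-* c zero        = sym (*-zeroʳ c)
Σ<-* c (suc n) {f} = trans (cong (c * f 0 +_) (Σ<-* c n)) (sym (*-distribˡ-+ c (f 0) _))

Σ<-last : ∀ n (f : ℕ → ℕ) → Σ< (suc n) f ≡ Σ< n f + f n
Σ<-last zero    f = +-comm (f 0) 0
Σ<-last (suc n) f = trans (cong (f 0 +_) (Σ<-last n (f ∘ suc))) (sym (+-assoc (f 0) _ _))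

Σ<-trim : ∀ {m n} {f : ℕ → ℕ} → m ≤ n → (∀ i → m ≤ i → i < n → f i ≡ 0) → Σ< n f ≡ Σ< m f
Σ<-trim {n = n} z≤n       eq = trans (Σ<-cong n (λ i → eq i z≤n)) (Σ<-0 n)
Σ<-trim         (s≤s m≤n) eq = cong (_ +_) (Σ<-trim m≤n (λ i m≤i i<n → eq (suc i) (s≤s m≤i) (s<s i<n)))

Σ<-single : ∀ n (f : ℕ → ℕ) j → j < n → (∀ i → i ≢ j → f i ≡ 0) → Σ< n f ≡ f j
Σ<-single (suc n) f zero    _         eq =
  trans (cong (f 0 +_) (trans (Σ<-cong n (λ i _ → eq (suc i) λ ())) (Σ<-0 n))) (+-identityʳ (f 0))
Σ<-single (suc n) f (suc j) (s<s j<n) eq =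
  trans (cong (_+ Σ< n (f ∘ suc)) (eq 0 λ ()))
        (Σ<-single n (f ∘ suc) j j<n (λ i i≢j → eq (suc i) (i≢j ∘ suc-injective)))

[_]ᵇ : Bool → ℕ
[ b ]ᵇ = if b then 1 else 0

count≡Σ : (p : α → Bool) (l : List α) → count p l ≡ Σ[ l ] (λ x → [ p x ]ᵇ)
count≡Σ p []      = refl
count≡Σ p (x ∷ l) with p x
... | true  = cong suc (count≡Σ p l)
... | false = count≡Σ p l

[∧]≡* : ∀ a b → [ a ∧ b ]ᵇ ≡ [ a ]ᵇ * [ b ]ᵇ
[∧]≡* true  b = sym (*-identityˡ _)
[∧]≡* false b = refl

-- Duplicate-free lists and reordering

extract : {x : α} {ys : List α} → x ∈ ys → ∃ λ zs → ys ↭ x ∷ zs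
extract {x = x} x∈ys with p , q , refl ← ∈-∃++ x∈ys = p ++ q , ↭.shift x p q

extract-⊆ : {x : α} {xs ys zs : List α} → Unique (x ∷ xs) → x ∷ xs ⊆ ys → ys ↭ x ∷ zs → xs ⊆ zs
extract-⊆ u sub p y∈xs with ↭.∈-resp-↭ p (sub (there y∈xs))
... | here refl = ⊥-elim (Unique[x∷xs]⇒x∉xs u y∈xs)
... | there y∈  = y∈

unique-⊆-length : {xs ys : List α} → Unique xs → xs ⊆ ys → length xs ≤ length ys
unique-⊆-length {xs = []}     _           _   = z≤n
unique-⊆-length {xs = x ∷ xs} u@(_ ∷ uxs) sub with zs , p ← extract (sub (here refl)) =
  subst (suc (length xs) ≤_) (sym (↭.↭-length p)) (s≤s (unique-⊆-length uxs (extract-⊆ u sub p)))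

-- Both families are defined by filtering words, in lexicographic order. This allows a sum over them
-- to be taken in the order of a generating tree, by comparing members only.
unique-sameElements-↭ : {xs ys : List α} → Unique xs → Unique ys → xs ⊆ ys → ys ⊆ xs → xs ↭ ys
unique-sameElements-↭ {xs = []} {[]}    _ _ _ _   = ↭-refl
unique-sameElements-↭ {xs = []} {y ∷ _} _ _ _ sub with () ← sub (here refl)
unique-sameElements-↭ {xs = x ∷ xs} {ys} u@(_ ∷ uxs) uys sub sup with zs , p ← extract (sub (here refl)) =
  ↭-trans (prep x (unique-sameElements-↭ uxs uzs (extract-⊆ u sub p) zs⊆xs)) (↭-sym p)
  where
  u′ : Unique (x ∷ zs)
  u′ = ↭ₛ.Unique-resp-↭ (setoid _) (↭⇒↭ₛ p) uys
  uzs : Unique zs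
  uzs with _ ∷ v ← u′ = v
  zs⊆xs : zs ⊆ xs
  zs⊆xs {y} y∈ with sup (↭.∈-resp-↭ (↭-sym p) (there y∈))
  ... | here refl = ⊥-elim (Unique[x∷xs]⇒x∉xs u′ y∈)
  ... | there y∈′ = y∈′

-- A map that recovers `x` from every member of `f x` forces the lists `f x` to be disjoint.
unique-concatMap : (f : α → List β) (parent : β → α) {xs : List α} → Unique xs →
                   (∀ {x} → x ∈ xs → Unique (f x)) →
                   (∀ {x y} → x ∈ xs → y ∈ f x → parent y ≡ x) → Unique (concatMap f xs)
unique-concatMap f parent {[]}     _           uf pf = []
unique-concatMap f parent {x ∷ xs} u@(_ ∷ uxs) uf pf =
  ++⁺ (uf (here refl)) (unique-concatMap f parent uxs (uf ∘ there) (pf ∘ there))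
      λ { (y∈fx , y∈rest) → disjoint y∈fx (find (∈-concatMap⁻ f {xs = xs} y∈rest)) }
  where
  disjoint : ∀ {y} → y ∈ f x → (∃ λ z → z ∈ xs × y ∈ f z) → _
  disjoint y∈fx (z , z∈xs , y∈fz) = Unique[x∷xs]⇒x∉xs u
    (subst (_∈ xs) (trans (sym (pf (there z∈xs) y∈fz)) (pf (here refl) y∈fx)) z∈xs)

-- Boolean membership and the list of all words

T⇒≡true : ∀ {b} → T b → b ≡ true
T⇒≡true = Equivalence.to T-≡

≡true⇒T : ∀ {b} → b ≡ true → T b
≡true⇒T = Equivalence.from T-≡

¬T⇒≡false : ∀ {b} → ¬ T b → b ≡ false
¬T⇒≡false {false} _  = refl
¬T⇒≡false {true}  ¬t = ⊥-elim (¬t _)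

elemᵇ⁺ : ∀ {v l} → v ∈ l → elemᵇ v l ≡ true
elemᵇ⁺ {v} (here refl) rewrite T⇒≡true (≡⇒≡ᵇ v v refl) = refl
elemᵇ⁺ {v} {x ∷ l} (there p) with v ≡ᵇ x
... | true  = refl
... | false = elemᵇ⁺ p

elemᵇ⁻ : ∀ v l → elemᵇ v l ≡ true → v ∈ l
elemᵇ⁻ v (x ∷ l) eq with v ≡ᵇ x in q
... | true  = here (≡ᵇ⇒≡ v x (≡true⇒T q))
... | false = there (elemᵇ⁻ v l eq)

∈-words⁺ : ∀ {k} l → All (_< k) l → l ∈ words (length l) k
∈-words⁺ []      _        = here refl
∈-words⁺ {k} (v ∷ l) (p ∷ ps) =
  ∈-concatMap⁺ (λ v → map (v ∷_) (words (length l) k)) (lose (∈-upTo⁺ p) (∈-map⁺ (v ∷_) (∈-words⁺ l ps)))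

∈-words⁻ : ∀ m {k l} → l ∈ words m k → length l ≡ m × All (_< k) l
∈-words⁻ zero    (here refl) = refl , []
∈-words⁻ (suc m) {k} p
  with v , v∈ , q ← find (∈-concatMap⁻ (λ v → map (v ∷_) (words m k)) {xs = upTo k} p)
  with l′ , l′∈ , refl ← ∈-map⁻ (v ∷_) q
  with eq , all ← ∈-words⁻ m l′∈ = cong suc eq , ∈-upTo⁻ v∈ ∷ all

words-unique : ∀ m k → Unique (words m k)
words-unique zero    k = [] ∷ []
words-unique (suc m) k = unique-concatMap _ head₀ (upTo⁺ k)
  (λ _ → map⁺ (λ { refl → refl }) (words-unique m k)) λ _ y∈ → head-map y∈
  where
  head₀ : List ℕ → ℕ
  head₀ []      = 0
  head₀ (v ∷ _) = v
  head-map : ∀ {v l} → l ∈ map (v ∷_) (words m k) → head₀ l ≡ v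
  head-map p with _ , _ , refl ← ∈-map⁻ _ p = refl

-- Pairs and triples of entries

any-cong : {p q : α → Bool} → (∀ x → p x ≡ q x) → ∀ l → any p l ≡ any q l
any-cong eq []      = refl
any-cong eq (x ∷ l) = cong₂ _∨_ (eq x) (any-cong eq l)

any-++ : (p : α → Bool) (l m : List α) → any p (l ++ m) ≡ any p l ∨ any p m
any-++ p []      m = refl
any-++ p (x ∷ l) m = trans (cong (p x ∨_) (any-++ p l m)) (sym (∨-assoc (p x) _ _))

any-map : (p : β → Bool) (f : α → β) (l : List α) → any p (map f l) ≡ any (p ∘ f) l
any-map p f []      = refl
any-map p f (x ∷ l) = cong (p (f x) ∨_) (any-map p f l)

any-false : (l : List α) → any (λ _ → false) l ≡ false
any-false []      = refl
any-false (_ ∷ l) = any-false l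

any-∈ : (p : α → Bool) {x : α} {l : List α} → x ∈ l → p x ≡ true → any p l ≡ true
any-∈ p (here refl) eq rewrite eq = refl
any-∈ p {l = y ∷ l} (there x∈) eq = trans (cong (p y ∨_) (any-∈ p x∈ eq)) (∨-zeroʳ (p y))

any-none : (p : α → Bool) (l : List α) → (∀ {x} → x ∈ l → p x ≡ false) → any p l ≡ false
any-none p []      eq = refl
any-none p (x ∷ l) eq = cong₂ _∨_ (eq (here refl)) (any-none p l (eq ∘ there))

-- Structural recursion in place of the lists `pairs` and `triples`, so that mapping, appending and
-- inserting can be followed entry by entry.
anyPair : (ℕ → ℕ → Bool) → List ℕ → Bool
anyPair p []      = false
anyPair p (a ∷ l) = any (p a) l ∨ anyPair p l

anyTriple : (ℕ → ℕ → ℕ → Bool) → List ℕ → Bool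
anyTriple p []      = false
anyTriple p (a ∷ l) = anyPair (p a) l ∨ anyTriple p l

any-pairs : (q : ℕ × ℕ → Bool) → ∀ l → any q (pairs l) ≡ anyPair (λ a b → q (a , b)) l
any-pairs q []      = refl
any-pairs q (a ∷ l) = trans (any-++ q (map (a ,_) l) (pairs l))
  (cong₂ _∨_ (any-map q (a ,_) l) (any-pairs q l))

any-triples : (q : ℕ × ℕ × ℕ → Bool) → ∀ l → any q (triples l) ≡ anyTriple (λ a b c → q (a , b , c)) l
any-triples q []      = refl
any-triples q (a ∷ l) = trans (any-++ q (map _ (pairs l)) (triples l))
  (cong₂ _∨_ (trans (any-map q _ (pairs l)) (any-pairs _ l)) (any-triples q l))

anyPair-cong : {p q : ℕ → ℕ → Bool} → (∀ a b → p a b ≡ q a b) → ∀ l → anyPair p l ≡ anyPair q l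
anyPair-cong eq []      = refl
anyPair-cong eq (a ∷ l) = cong₂ _∨_ (any-cong (eq a) l) (anyPair-cong eq l)

anyTriple-cong : {p q : ℕ → ℕ → ℕ → Bool} → (∀ a b c → p a b c ≡ q a b c) →
                 ∀ l → anyTriple p l ≡ anyTriple q l
anyTriple-cong eq []      = refl
anyTriple-cong eq (a ∷ l) = cong₂ _∨_ (anyPair-cong (eq a) l) (anyTriple-cong eq l)

anyPair-map : (p : ℕ → ℕ → Bool) (f : ℕ → ℕ) → ∀ l →
              anyPair p (map f l) ≡ anyPair (λ a b → p (f a) (f b)) l
anyPair-map p f []      = refl
anyPair-map p f (a ∷ l) = cong₂ _∨_ (any-map (p (f a)) f l) (anyPair-map p f l)

anyTriple-map : (p : ℕ → ℕ → ℕ → Bool) (f : ℕ → ℕ) → ∀ l →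
                anyTriple p (map f l) ≡ anyTriple (λ a b c → p (f a) (f b) (f c)) l
anyTriple-map p f []      = refl
anyTriple-map p f (a ∷ l) = cong₂ _∨_ (anyPair-map (p (f a)) f l) (anyTriple-map p f l)

∨-interchange : ∀ a b c d → (a ∨ b) ∨ (c ∨ d) ≡ (a ∨ c) ∨ (b ∨ d)
∨-interchange true  b     c d = refl
∨-interchange false false c d = refl
∨-interchange false true  c d = sym (∨-zeroʳ c)

anyPair-∷ʳ : (p : ℕ → ℕ → Bool) → ∀ l d →
             anyPair p (l ∷ʳ d) ≡ anyPair p l ∨ any (λ a → p a d) l
anyPair-∷ʳ p []      d = refl
anyPair-∷ʳ p (a ∷ l) d = begin
  any (p a) (l ∷ʳ d) ∨ anyPair p (l ∷ʳ d)
    ≡⟨ cong₂ _∨_ (trans (any-++ (p a) l (d ∷ [])) (cong (any (p a) l ∨_) (∨-identityʳ (p a d)))) (anyPair-∷ʳ p l d) ⟩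
  (any (p a) l ∨ p a d) ∨ (anyPair p l ∨ any (λ a → p a d) l)
    ≡⟨ ∨-interchange (any (p a) l) _ _ _ ⟩
  (any (p a) l ∨ anyPair p l) ∨ (p a d ∨ any (λ a → p a d) l) ∎
  where open ≡-Reasoning

anyTriple-∷ʳ : (p : ℕ → ℕ → ℕ → Bool) → ∀ l d →
               anyTriple p (l ∷ʳ d) ≡ anyTriple p l ∨ anyPair (λ a b → p a b d) l
anyTriple-∷ʳ p []      d = refl
anyTriple-∷ʳ p (a ∷ l) d =
  trans (cong₂ _∨_ (anyPair-∷ʳ (p a) l d) (anyTriple-∷ʳ p l d)) (∨-interchange (anyPair (p a) l) _ _ _)

≤ᵇ'≡<ᵇ : ∀ a b → (a ≤ᵇ' b) ≡ (a <ᵇ suc b)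
≤ᵇ'≡<ᵇ zero    zero    = refl
≤ᵇ'≡<ᵇ zero    (suc b) = refl
≤ᵇ'≡<ᵇ (suc a) zero    = refl
≤ᵇ'≡<ᵇ (suc a) (suc b) = ≤ᵇ'≡<ᵇ a b

stop-anyTriple : ∀ l → containsStop l ≡ anyTriple (λ a b c → (a <ᵇ suc b) ∧ (b <ᵇ suc c)) l
stop-anyTriple l = trans (any-triples _ l)
  (anyTriple-cong (λ a b c → cong₂ _∧_ (≤ᵇ'≡<ᵇ a b) (≤ᵇ'≡<ᵇ b c)) l)

-- The bound on the top `b` is strict: a last rank `d` completes the weak ascents with top at most
-- `d`, which is the case `c = suc d`.
ascentBelow : List ℕ → ℕ → Bool
ascentBelow l c = anyPair (λ a b → (a <ᵇ suc b) ∧ (b <ᵇ c)) l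

stop-∷ʳ : ∀ l d → containsStop (l ∷ʳ d) ≡ containsStop l ∨ ascentBelow l (suc d)
stop-∷ʳ l d = trans (stop-anyTriple (l ∷ʳ d))
  (trans (anyTriple-∷ʳ _ l d) (cong (_∨ ascentBelow l (suc d)) (sym (stop-anyTriple l))))

init-∷ʳ : ∀ l d → init (l ∷ʳ d) ≡ l
init-∷ʳ []          d = refl
init-∷ʳ (a ∷ [])    d = refl
init-∷ʳ (a ∷ b ∷ l) d = cong (a ∷_) (init-∷ʳ (b ∷ l) d)

-- Insertion of a last variable into a chain

-- The increasing injection of ℕ that omits `g`; it frees rank `g` for a new block, and `lower g`
-- closes that rank again.
raise : ℕ → ℕ → ℕ
raise zero    v       = suc v
raise (suc g) zero    = zero
raise (suc g) (suc v) = suc (raise g v)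

lower : ℕ → ℕ → ℕ
lower zero    v       = pred v
lower (suc g) zero    = zero
lower (suc g) (suc v) = suc (lower g v)

raise-≢ : ∀ g v → g ≢ raise g v
raise-≢ (suc g) (suc v) eq = raise-≢ g v (suc-injective eq)

lower-raise : ∀ g v → lower g (raise g v) ≡ v
lower-raise zero    v       = refl
lower-raise (suc g) zero    = refl
lower-raise (suc g) (suc v) = cong suc (lower-raise g v)

raise-lower : ∀ g v → g ≢ v → raise g (lower g v) ≡ v
raise-lower zero    zero    ne = ⊥-elim (ne refl)
raise-lower zero    (suc v) ne = refl
raise-lower (suc g) zero    ne = refl
raise-lower (suc g) (suc v) ne = cong suc (raise-lower g v (ne ∘ cong suc))

raise-< : ∀ g {v k} → v < k → raise g v < suc k
raise-< zero            v<k         = s<s v<k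
raise-< (suc g) {zero}  _           = z<s
raise-< (suc g) {suc v} (s<s v<k)   = s<s (raise-< g v<k)

lower-< : ∀ g {v k} → g < suc k → v < suc k → g ≢ v → lower g v < k
lower-< zero    {zero}          _         _           ne = ⊥-elim (ne refl)
lower-< zero    {suc v}         _         (s<s v<k)   ne = v<k
lower-< (suc g) {zero}  {suc k} _         _           ne = z<s
lower-< (suc g) {zero}  {zero}  (s<s ())
lower-< (suc g) {suc v} {zero}  (s<s ())
lower-< (suc g) {suc v} {suc k} (s<s g<k) (s<s v<k)   ne = s<s (lower-< g g<k v<k (ne ∘ cong suc))

lower-≤ : ∀ g {c k} → g ≤ k → c ≤ suc k → lower g c ≤ k
lower-≤ zero            _         c≤        = pred-mono-≤ c≤
lower-≤ (suc g) {zero}  _         _         = z≤n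
lower-≤ (suc g) {suc c} (s≤s g≤k) (s≤s c≤k) = s≤s (lower-≤ g g≤k c≤k)

lower-below : ∀ {g c} → c ≤ g → lower g c ≡ c
lower-below {zero}  z≤n       = refl
lower-below {suc g} z≤n       = refl
lower-below {suc g} (s≤s c≤g) = cong suc (lower-below c≤g)

raise-≤ᵇ : ∀ g a b → (raise g a <ᵇ suc (raise g b)) ≡ (a <ᵇ suc b)
raise-≤ᵇ zero    a       b       = refl
raise-≤ᵇ (suc g) zero    b       = refl
raise-≤ᵇ (suc g) (suc a) zero    = refl
raise-≤ᵇ (suc g) (suc a) (suc b) = raise-≤ᵇ g a b

-- An adjunction: `lower g c` is the number of old ranks that land below `c` once rank `g` has been
-- freed. It transports thresholds across an insertion.
raise-<ᵇ-lower : ∀ g b c → (raise g b <ᵇ c) ≡ (b <ᵇ lower g c)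
raise-<ᵇ-lower zero    b       zero    = refl
raise-<ᵇ-lower zero    b       (suc c) = refl
raise-<ᵇ-lower (suc g) zero    zero    = refl
raise-<ᵇ-lower (suc g) zero    (suc c) = refl
raise-<ᵇ-lower (suc g) (suc b) zero    = refl
raise-<ᵇ-lower (suc g) (suc b) (suc c) = raise-<ᵇ-lower g b c

stop-raise : ∀ g l → containsStop (map (raise g) l) ≡ containsStop l
stop-raise g l = trans (stop-anyTriple (map (raise g) l)) (trans (anyTriple-map _ (raise g) l)
  (trans (anyTriple-cong (λ a b c → cong₂ _∧_ (raise-≤ᵇ g a b) (raise-≤ᵇ g b c)) l) (sym (stop-anyTriple l))))

ascentBelow-raise : ∀ g l c → ascentBelow (map (raise g) l) c ≡ ascentBelow l (lower g c)
ascentBelow-raise g l c = trans (anyPair-map _ (raise g) l)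
  (anyPair-cong (λ a b → cong₂ _∧_ (raise-≤ᵇ g a b) (raise-<ᵇ-lower g b c)) l)

-- One more than the largest rank; for a rank list this is the number of blocks.
blocks : List ℕ → ℕ
blocks = foldr (λ v b → suc v ⊔ b) 0

newBlock : List ℕ → ℕ → List ℕ
newBlock l g = map (raise g) l ∷ʳ g

children : List ℕ → List (List ℕ)
children l = map (newBlock l) (upTo (suc (blocks l))) ++ map (l ∷ʳ_) (upTo (blocks l))

record Packed (k : ℕ) (l : List ℕ) : Set where
  constructor packed
  field
    bounded : ∀ {v} → v ∈ l → v < k
    onto    : ∀ {v} → v < k → v ∈ l
open Packed

∈⇒<blocks : ∀ {v l} → v ∈ l → v < blocks l
∈⇒<blocks {l = x ∷ l} (here refl) = m≤m⊔n (suc x) (blocks l)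
∈⇒<blocks {l = x ∷ l} (there v∈)  = ≤-trans (∈⇒<blocks v∈) (m≤n⊔m (suc x) (blocks l))

blocks-max : ∀ l {b} → blocks l ≡ suc b → b ∈ l
blocks-max (x ∷ l) eq with ⊔-sel (suc x) (blocks l)
... | inj₁ p = here (suc-injective (trans (sym eq) p))
... | inj₂ p = there (blocks-max l (trans (sym p) eq))

packed-blocks : ∀ {k l} → Packed k l → blocks l ≡ k
packed-blocks {k} {l} p = ≤-antisym (upper (blocks l) refl) (lower′ k refl)
  where
  upper : ∀ b → blocks l ≡ b → b ≤ k
  upper zero    _  = z≤n
  upper (suc b) eq = bounded p (blocks-max l eq)
  lower′ : ∀ j → j ≡ k → j ≤ blocks l
  lower′ zero    _    = z≤n
  lower′ (suc j) refl = ∈⇒<blocks (onto p (n<1+n j))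

-- Pigeonhole. It makes the ranks fit the alphabet of size `length l` from which `WOC` draws its
-- words.
packed-length : ∀ {k l} → Packed k l → k ≤ length l
packed-length {k} {l} p = subst (_≤ length l) (length-upTo k)
  (unique-⊆-length (upTo⁺ k) (onto p ∘ ∈-upTo⁻))

∈-∷ʳ⁻ : ∀ {v d : ℕ} l → v ∈ l ∷ʳ d → v ∈ l ⊎ v ≡ d
∈-∷ʳ⁻ l v∈ with ∈-++⁻ l v∈
... | inj₁ p        = inj₁ p
... | inj₂ (here p) = inj₂ p

packed-oldBlock : ∀ {k l b} → Packed k l → b < k → Packed k (l ∷ʳ b)
packed-oldBlock {k} {l} {b} p b<k = packed bd (∈-++⁺ˡ ∘ onto p)
  where
  bd : ∀ {v} → v ∈ l ∷ʳ b → v < k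
  bd v∈ with ∈-∷ʳ⁻ l v∈
  ... | inj₁ q    = bounded p q
  ... | inj₂ refl = b<k

packed-newBlock : ∀ {k l g} → Packed k l → g ≤ k → Packed (suc k) (newBlock l g)
packed-newBlock {k} {l} {g} p g≤k = packed bd on
  where
  bd : ∀ {v} → v ∈ newBlock l g → v < suc k
  bd v∈ with ∈-∷ʳ⁻ (map (raise g) l) v∈
  ... | inj₂ refl = s≤s g≤k
  ... | inj₁ q with _ , u∈ , refl ← ∈-map⁻ (raise g) q = raise-< g (bounded p u∈)
  on : ∀ {v} → v < suc k → v ∈ newBlock l g
  on {v} v< with g ≟ v
  ... | yes refl = ∈-++⁺ʳ (map (raise g) l) (here refl)
  ... | no g≢v = ∈-++⁺ˡ (subst (_∈ map (raise g) l) (raise-lower g v g≢v)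
                   (∈-map⁺ (raise g) (onto p (lower-< g (s≤s g≤k) v< g≢v))))

all⁻ : (p : α → Bool) → ∀ l → all p l ≡ true → ∀ {x} → x ∈ l → p x ≡ true
all⁻ p (x ∷ l) eq       (here refl) with p x
... | true = refl
all⁻ p (x ∷ l) eq       (there y∈)  with p x
... | true = all⁻ p l eq y∈

all⁺ : (p : α → Bool) → ∀ l → (∀ {x} → x ∈ l → p x ≡ true) → all p l ≡ true
all⁺ p []      h = refl
all⁺ p (x ∷ l) h = cong₂ _∧_ (h (here refl)) (all⁺ p l (h ∘ there))

∈-WOC⁺ : ∀ {k} l → Packed k l → l ∈ WOC (length l)
∈-WOC⁺ {k} l p = ∈-filter⁺ (λ l′ → T? (isRankList (length l) l′))
  (∈-words⁺ l (All.tabulate (λ v∈ → ≤-trans (bounded p v∈) (packed-length p))))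
  (≡true⇒T (all⁺ _ (upTo (length l)) (λ {v} _ → closed v)))
  where
  closed : ∀ v → (not (elemᵇ (suc v) l) ∨ elemᵇ v l) ≡ true
  closed v with elemᵇ (suc v) l in eq
  ... | false = refl
  ... | true  = elemᵇ⁺ (onto p (<-trans (n<1+n v) (bounded p (elemᵇ⁻ (suc v) l eq))))

∈-WOC⁻ : ∀ n {l} → l ∈ WOC n → length l ≡ n × Packed (blocks l) l
∈-WOC⁻ n {l} l∈ with l∈w , t ← ∈-filter⁻ (λ l′ → T? (isRankList n l′)) {xs = words n n} l∈
  with len , bnd ← ∈-words⁻ n l∈w = len , packed ∈⇒<blocks (λ {v} → on v (blocks l) refl)
  where
  down : ∀ {v} → suc v ∈ l → v ∈ l
  down {v} sv∈ = go (all⁻ _ (upTo n) (T⇒≡true t) (∈-upTo⁺ (<-trans (n<1+n v) (All.lookup bnd sv∈))))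
    where
    go : (not (elemᵇ (suc v) l) ∨ elemᵇ v l) ≡ true → v ∈ l
    go eq rewrite elemᵇ⁺ sv∈ = elemᵇ⁻ v l eq
  -- The test in `isRankList` goes down one rank at a time, so all ranks are reached from the
  -- largest one, which occurs by `blocks-max`.
  descend : ∀ {v b} → v ≤′ b → b ∈ l → v ∈ l
  descend ≤′-refl       b∈ = b∈
  descend (≤′-step v≤b) b∈ = descend v≤b (down b∈)
  on : ∀ v b → blocks l ≡ b → v < b → v ∈ l
  on v (suc b) eq (s≤s v≤b) = descend (≤⇒≤′ v≤b) (blocks-max l eq)

length-newBlock : ∀ l g → length (newBlock l g) ≡ suc (length l)
length-newBlock l g = trans (length-++ (map (raise g) l)) (trans (+-comm _ 1) (cong suc (length-map (raise g) l)))

length-∷ʳ : ∀ (l : List ℕ) d → length (l ∷ʳ d) ≡ suc (length l)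
length-∷ʳ l d = trans (length-++ l) (+-comm _ 1)

∈-children⁻ : ∀ l {c} → c ∈ children l →
              (∃ λ g → g ≤ blocks l × c ≡ newBlock l g) ⊎ (∃ λ b → b < blocks l × c ≡ l ∷ʳ b)
∈-children⁻ l c∈ with ∈-++⁻ (map (newBlock l) (upTo (suc (blocks l)))) c∈
... | inj₁ p with g , g∈ , eq ← ∈-map⁻ (newBlock l) p = inj₁ (g , s≤s⁻¹ (∈-upTo⁻ g∈) , eq)
... | inj₂ p with b , b∈ , eq ← ∈-map⁻ (l ∷ʳ_) p = inj₂ (b , ∈-upTo⁻ b∈ , eq)

children⊆WOC : ∀ n {l c} → l ∈ WOC n → c ∈ children l → c ∈ WOC (suc n)
children⊆WOC n {l} l∈ c∈ with refl , p ← ∈-WOC⁻ n l∈ with ∈-children⁻ l c∈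
... | inj₁ (g , g≤ , refl) = subst (λ m → newBlock l g ∈ WOC m) (length-newBlock l g) (∈-WOC⁺ _ (packed-newBlock p g≤))
... | inj₂ (b , b< , refl) = subst (λ m → l ∷ʳ b ∈ WOC m) (length-∷ʳ l b) (∈-WOC⁺ _ (packed-oldBlock p b<))

-- If rank `d` still occurs, the last variable shared its block and the remaining ranks are already
-- normalised. Otherwise it was alone, and the rank it leaves empty must be closed.
parentOf : List ℕ → ℕ → List ℕ
parentOf l d = if elemᵇ d l then l else map (lower d) l

WOC⊆children : ∀ n {c} → c ∈ WOC (suc n) → c ∈ concatMap children (WOC n)
WOC⊆children n {c} c∈ with len , p ← ∈-WOC⁻ (suc n) c∈ with initLast c
... | l ∷ʳ′ d with elemᵇ d l in eq | suc-injective (trans (sym (length-∷ʳ l d)) len)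
... | true | refl = ∈-concatMap⁺ children (lose (∈-WOC⁺ l p′)
                      (∈-++⁺ʳ _ (∈-map⁺ (l ∷ʳ_) (∈-upTo⁺ (subst (d <_) (sym (packed-blocks p′)) d<)))))
  where
  k  = blocks (l ∷ʳ d)
  d< = bounded p (∈-++⁺ʳ l (here refl))
  p′ : Packed k l
  p′ = packed (bounded p ∘ ∈-++⁺ˡ) on
    where
    on : ∀ {v} → v < k → v ∈ l
    on v< with ∈-∷ʳ⁻ l (onto p v<)
    ... | inj₁ q    = q
    ... | inj₂ refl = elemᵇ⁻ d l eq
... | false | refl = go (blocks (l ∷ʳ d)) refl
  where
  d∉l : d ∉ l
  d∉l d∈ with () ← trans (sym eq) (elemᵇ⁺ d∈)
  l′ = map (lower d) l
  raised : map (raise d) l′ ≡ l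
  raised = trans (sym (map-∘ l)) (map-id-local (All.tabulate λ {v} v∈ → raise-lower d v λ { refl → d∉l v∈ }))
  go : ∀ k → blocks (l ∷ʳ d) ≡ k → l ∷ʳ d ∈ concatMap children (WOC (length l))
  go zero    beq with () ← subst (d <_) beq (bounded p (∈-++⁺ʳ l (here refl)))
  go (suc k) beq = ∈-concatMap⁺ children (lose
    (subst (λ m → l′ ∈ WOC m) (length-map (lower d) l) (∈-WOC⁺ l′ p′))
    (∈-++⁺ˡ (subst (λ m → m ∷ʳ d ∈ map (newBlock l′) (upTo (suc (blocks l′)))) raised
      (∈-map⁺ (newBlock l′) (∈-upTo⁺ (subst (λ b → d < suc b) (sym (packed-blocks p′)) d<))))))
    where
    bd : ∀ {v} → v ∈ l ∷ʳ d → v < suc k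
    bd v∈ = subst (_ <_) beq (bounded p v∈)
    d< = bd (∈-++⁺ʳ l (here refl))
    on : ∀ {v} → v < k → v ∈ l′
    on {v} v<k with ∈-∷ʳ⁻ l (onto p (subst (raise d v <_) (sym beq) (raise-< d v<k)))
    ... | inj₁ q = subst (_∈ l′) (lower-raise d v) (∈-map⁺ (lower d) q)
    ... | inj₂ q = ⊥-elim (raise-≢ d v (sym q))
    p′ : Packed k l′
    p′ = packed (λ v∈ → let u , u∈ , veq = ∈-map⁻ (lower d) v∈ in
                   subst (_< k) (sym veq) (lower-< d d< (bd (∈-++⁺ˡ u∈)) λ d≡u → d∉l (subst (_∈ l) (sym d≡u) u∈))) on

parent : List ℕ → List ℕ
parent c with initLast c
... | []      = []
... | l ∷ʳ′ d = parentOf l d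

initLast-∷ʳ : ∀ {α : Set} (l : List α) d → initLast (l ∷ʳ d) ≡ (l ∷ʳ′ d)
initLast-∷ʳ []      d = refl
initLast-∷ʳ (x ∷ l) d rewrite initLast-∷ʳ l d = refl

parent-∷ʳ : ∀ l d → parent (l ∷ʳ d) ≡ parentOf l d
parent-∷ʳ l d rewrite initLast-∷ʳ l d = refl

parent-child : ∀ n {l c} → l ∈ WOC n → c ∈ children l → parent c ≡ l
parent-child n {l} l∈ c∈ with _ , p ← ∈-WOC⁻ n l∈ with ∈-children⁻ l c∈
... | inj₂ (b , b< , refl) = trans (parent-∷ʳ l b)
        (cong (λ t → if t then l else map (lower b) l) (elemᵇ⁺ (onto p b<)))
... | inj₁ (g , g≤ , refl) = trans (parent-∷ʳ (map (raise g) l) g) (helper (elemᵇ g (map (raise g) l)) refl)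
  where
  helper : ∀ t → elemᵇ g (map (raise g) l) ≡ t →
           (if t then map (raise g) l else map (lower g) (map (raise g) l)) ≡ l
  helper true  eq with v , _ , veq ← ∈-map⁻ (raise g) (elemᵇ⁻ g (map (raise g) l) eq) = ⊥-elim (raise-≢ g v veq)
  helper false _  = trans (sym (map-∘ l)) (map-id-local (All.tabulate λ {v} _ → lower-raise g v))

-- The last rank separates children of the same kind. It occurs earlier in the list for an old block
-- and does not for a new one, which separates the two kinds.
children-unique : ∀ n {l} → l ∈ WOC n → Unique (children l)
children-unique n {l} l∈ with _ , p ← ∈-WOC⁻ n l∈ =
  ++⁺ (map⁺ (λ eq → proj₂ (∷ʳ-injective (map _ l) (map _ l) eq)) (upTo⁺ _))
      (map⁺ (λ eq → proj₂ (∷ʳ-injective l l eq)) (upTo⁺ _))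
      λ (c∈₁ , c∈₂) → disjoint (∈-map⁻ (newBlock l) c∈₁) (∈-map⁻ (l ∷ʳ_) c∈₂)
  where
  disjoint : ∀ {c} → (∃ λ g → g ∈ upTo _ × c ≡ newBlock l g) → (∃ λ b → b ∈ upTo (blocks l) × c ≡ l ∷ʳ b) → ⊥
  disjoint (g , _ , refl) (b , b∈ , eq) with eq₁ , refl ← ∷ʳ-injective (map (raise g) l) l eq
    with v , _ , veq ← ∈-map⁻ (raise g) (subst (g ∈_) (sym eq₁) (onto p (∈-upTo⁻ b∈))) = raise-≢ g v veq

WOC-unique : ∀ n → Unique (WOC n)
WOC-unique n = filter⁺ (λ l → T? (isRankList n l)) (words-unique n n)

WOC-suc : ∀ n → WOC (suc n) ↭ concatMap children (WOC n)
WOC-suc n = unique-sameElements-↭ (WOC-unique (suc n))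
  (unique-concatMap children parent (WOC-unique n) (children-unique n) (parent-child n))
  (WOC⊆children n)
  (λ c∈ → let _ , l∈ , c∈l = find (∈-concatMap⁻ children {xs = WOC n} c∈) in children⊆WOC n l∈ c∈l)

Σ-WOC-suc : ∀ n {f : List ℕ → ℕ} → Σ[ WOC (suc n) ] f ≡ Σ[ WOC n ] (λ l → Σ[ children l ] f)
Σ-WOC-suc n = trans (Σ-↭ (WOC-suc n)) (Σ-concatMap children (WOC n))

Σ-children : ∀ l {f : List ℕ → ℕ} →
             Σ[ children l ] f ≡ Σ< (suc (blocks l)) (f ∘ newBlock l) + Σ< (blocks l) (λ b → f (l ∷ʳ b))
Σ-children l {f} = trans (Σ-++ (map (newBlock l) (upTo (suc (blocks l)))) (map (l ∷ʳ_) (upTo (blocks l))))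
  (cong₂ _+_ (trans (Σ-map (newBlock l) (upTo (suc (blocks l))) {f}) (Σ-upTo (suc (blocks l)) {f ∘ newBlock l}))
             (trans (Σ-map (l ∷ʳ_) (upTo (blocks l)) {f}) (Σ-upTo (blocks l) {λ b → f (l ∷ʳ b)})))

-- The label h of a chain is the number of blocks strictly below the lowest top
-- of an earlier weak ascent: the avoiding children are exactly those which put
-- the new variable into one of the first h blocks or one of the gaps 0,…,h.
-- J n h c sums 2 (number of blocks) over the avoiding descendants n levels below
-- a chain with label h and c / 2 blocks.
J : ℕ → ℕ → ℕ → ℕ
J zero    h c = c
J (suc n) h c = J n (suc h) (2 + c) + Σ< h (λ i → J n (suc i) (2 + c) + J n i c)

-- The restriction `c ≤ blocks l` in `threshold` lets a chain without weak ascents have label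
-- `blocks l`: every block and every gap is then admissible.
record Label (h : ℕ) (l : List ℕ) : Set where
  field
    isPacked  : Packed (blocks l) l
    h≤blocks  : h ≤ blocks l
    avoids    : containsStop l ≡ false
    threshold : ∀ {c} → c ≤ blocks l → ascentBelow l c ≡ (h <ᵇ c)
open Label

<⇒<ᵇ≡true : ∀ {m n} → m < n → (m <ᵇ n) ≡ true
<⇒<ᵇ≡true m<n = T⇒≡true (<⇒<ᵇ m<n)

≥⇒<ᵇ≡false : ∀ {m n} → n ≤ m → (m <ᵇ n) ≡ false
≥⇒<ᵇ≡false {m} {n} n≤m = ¬T⇒≡false (λ t → ≤⇒≯ n≤m (<ᵇ⇒< m n t))

ascentBelow-∷ʳ : ∀ l d c → ascentBelow (l ∷ʳ d) c ≡
                 ascentBelow l c ∨ any (λ a → (a <ᵇ suc d) ∧ (d <ᵇ c)) l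
ascentBelow-∷ʳ l d c = anyPair-∷ʳ _ l d

-- One earlier entry at most `d` suffices to make the last entry `d` the top of a weak ascent, hence
-- a candidate for the lowest top.
any-≤-∈ : ∀ {l a d} c → a ∈ l → a ≤ d → any (λ a → (a <ᵇ suc d) ∧ (d <ᵇ c)) l ≡ (d <ᵇ c)
any-≤-∈ {l} {a} {d} c a∈ a≤d with d <ᵇ c
... | true  = any-∈ (λ a → (a <ᵇ suc d) ∧ true) a∈ (cong (_∧ true) (<⇒<ᵇ≡true (s≤s a≤d)))
... | false = any-none (λ a → (a <ᵇ suc d) ∧ false) l (λ {x} _ → ∧-zeroʳ (x <ᵇ suc d))

blocks-oldBlock : ∀ {l b} → Packed (blocks l) l → b < blocks l → blocks (l ∷ʳ b) ≡ blocks l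
blocks-oldBlock p b< = packed-blocks (packed-oldBlock p b<)

blocks-newBlock : ∀ {l g} → Packed (blocks l) l → g ≤ blocks l → blocks (newBlock l g) ≡ suc (blocks l)
blocks-newBlock p g≤ = packed-blocks (packed-newBlock p g≤)

stop-oldBlock : ∀ {h l b} → Label h l → b < blocks l → containsStop (l ∷ʳ b) ≡ (h <ᵇ suc b)
stop-oldBlock {h} {l} {b} L b< = trans (stop-∷ʳ l b)
  (cong₂ _∨_ (avoids L) (threshold L b<))

-- Weakly below gap `g` lie the `g` old blocks `0,…,g-1`, one fewer than weakly below a variable
-- placed in old block `g`. Hence there are h + 1 admissible gaps but only h admissible blocks.
stop-newBlock : ∀ {h l g} → Label h l → g ≤ blocks l → containsStop (newBlock l g) ≡ (h <ᵇ g)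
stop-newBlock {h} {l} {g} L g≤ = trans (stop-∷ʳ (map (raise g) l) g)
  (cong₂ _∨_ (trans (stop-raise g l) (avoids L))
    (trans (ascentBelow-raise g l (suc g)) (trans (cong (ascentBelow l) (lower-self g)) (threshold L g≤))))
  where
  lower-self : ∀ g → lower g (suc g) ≡ g
  lower-self zero    = refl
  lower-self (suc g) = cong suc (lower-self g)

label-oldBlock : ∀ {h l b} → Label h l → b < h → Label b (l ∷ʳ b)
label-oldBlock {h} {l} {b} L b<h = record
  { isPacked  = subst (λ k → Packed k (l ∷ʳ b)) (sym eq) (packed-oldBlock (isPacked L) b<)
  ; h≤blocks  = subst (b ≤_) (sym eq) (<⇒≤ b<)
  ; avoids    = trans (stop-oldBlock L b<) (≥⇒<ᵇ≡false b<h)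
  ; threshold = λ {c} c≤ → trans (ascentBelow-∷ʳ l b c)
      (trans (cong₂ _∨_ (threshold L (subst (c ≤_) eq c≤)) (any-≤-∈ c (onto (isPacked L) b<) ≤-refl)) (absorb c))
  }
  where
  b< = <-≤-trans b<h (h≤blocks L)
  eq = blocks-oldBlock (isPacked L) b<
  absorb : ∀ c → (h <ᵇ c) ∨ (b <ᵇ c) ≡ (b <ᵇ c)
  absorb c with h <? c
  ... | yes h<c rewrite <⇒<ᵇ≡true h<c = sym (<⇒<ᵇ≡true (<-trans b<h h<c))
  ... | no  h≮c rewrite ≥⇒<ᵇ≡false (≮⇒≥ h≮c) = refl

-- Gap 0 puts the new variable below all others, so it ends no weak ascent; the lowest top keeps its
-- place and gains one block beneath it.
label-bottom : ∀ {h l} → Label h l → Label (suc h) (newBlock l 0)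
label-bottom {h} {l} L = record
  { isPacked  = subst (λ k → Packed k (newBlock l 0)) (sym eq) (packed-newBlock (isPacked L) z≤n)
  ; h≤blocks  = subst (suc h ≤_) (sym eq) (s≤s (h≤blocks L))
  ; avoids    = stop-newBlock L z≤n
  ; threshold = λ {c} c≤ → trans (ascentBelow-∷ʳ (map suc l) 0 c)
      (trans (cong₂ _∨_ (ascentBelow-raise 0 l c)
                        (trans (any-map _ suc l) (any-none _ l (λ _ → refl))))
      (trans (∨-identityʳ _) (below c (subst (c ≤_) eq c≤))))
  }
  where
  eq = blocks-newBlock (isPacked L) z≤n
  below : ∀ c → c ≤ suc (blocks l) → ascentBelow l (pred c) ≡ (suc h <ᵇ c)
  below zero    _  = threshold L z≤n
  below (suc c) c≤ = threshold L (s≤s⁻¹ c≤)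

label-newBlock : ∀ {h l g} → Label h l → suc g ≤ h → Label (suc g) (newBlock l (suc g))
label-newBlock {h} {l} {g} L g<h = record
  { isPacked  = subst (λ k → Packed k (newBlock l (suc g))) (sym eq) (packed-newBlock (isPacked L) g≤)
  ; h≤blocks  = subst (suc g ≤_) (sym eq) (<⇒≤ (s≤s g≤))
  ; avoids    = trans (stop-newBlock L g≤) (≥⇒<ᵇ≡false g<h)
  ; threshold = λ {c} c≤ → trans (ascentBelow-∷ʳ (map (raise (suc g)) l) (suc g) c)
      (trans (cong₂ _∨_ (trans (ascentBelow-raise (suc g) l c)
                               (threshold L (lower-≤ (suc g) g≤ (subst (c ≤_) eq c≤))))
                        -- Rank 0 is fixed by `raise (suc g)` and lies below the new variable, so
                        -- the latter tops a weak ascent.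
                        (any-≤-∈ c (∈-map⁺ (raise (suc g)) (onto (isPacked L) (≤-trans z<s g≤))) z≤n))
             (absorb c))
  }
  where
  g≤ = ≤-trans g<h (h≤blocks L)
  eq = blocks-newBlock (isPacked L) g≤
  absorb : ∀ c → (h <ᵇ lower (suc g) c) ∨ (suc g <ᵇ c) ≡ (suc g <ᵇ c)
  absorb c with suc g <? c
  ... | yes g<c rewrite <⇒<ᵇ≡true g<c = ∨-zeroʳ _
  ... | no  g≮c rewrite lower-below (≮⇒≥ g≮c) | ≥⇒<ᵇ≡false (≮⇒≥ g≮c) =
    cong (_∨ false) (≥⇒<ᵇ≡false (≤-trans (≮⇒≥ g≮c) g<h))

-- Block sums over avoiding descendants

avoidSum : ℕ → List ℕ → ℕ
avoidSum zero    l = [ not (containsStop l) ]ᵇ * (blocks l + blocks l)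
avoidSum (suc n) l = Σ[ children l ] (avoidSum n)

Σ-WOC-avoidSum : ∀ m n → Σ[ WOC m ] (avoidSum n) ≡ avoidSum (m + n) []
Σ-WOC-avoidSum zero    n = +-identityʳ _
Σ-WOC-avoidSum (suc m) n = trans (Σ-WOC-suc m)
  (trans (Σ-WOC-avoidSum m (suc n)) (cong (λ k → avoidSum k []) (+-suc m n)))

stop-children : ∀ {l} → containsStop l ≡ true → ∀ {c} → c ∈ children l → containsStop c ≡ true
stop-children {l} s c∈ with ∈-children⁻ l c∈
... | inj₁ (g , _ , refl) = trans (stop-∷ʳ (map (raise g) l) g)
                                  (cong (_∨ ascentBelow (map (raise g) l) (suc g)) (trans (stop-raise g l) s))
... | inj₂ (b , _ , refl) = trans (stop-∷ʳ l b) (cong (_∨ ascentBelow l (suc b)) s)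

avoidSum-stop : ∀ n {l} → containsStop l ≡ true → avoidSum n l ≡ 0
avoidSum-stop zero    {l} s = cong (λ b → [ not b ]ᵇ * (blocks l + blocks l)) s
avoidSum-stop (suc n) {l} s = trans (Σ-cong (children l) (λ c c∈ → avoidSum-stop n (stop-children s c∈)))
                                    (Σ-0 (children l))

avoidSum-label : ∀ n {h l} → Label h l → avoidSum n l ≡ J n h (blocks l + blocks l)
avoidSum-label zero    {h} {l} L rewrite avoids L = +-identityʳ _
avoidSum-label (suc n) {h} {l} L = begin
  Σ[ children l ] (avoidSum n)
    ≡⟨ Σ-children l ⟩
  Σ< (suc k) (avoidSum n ∘ newBlock l) + Σ< k (λ b → avoidSum n (l ∷ʳ b))
    ≡⟨ cong₂ _+_
         -- Gaps above `h`, and below them blocks from `h` on, give children containing the stop,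
         -- whose subtrees contribute nothing.
         (Σ<-trim (s≤s (h≤blocks L)) (λ g h<g g≤k → avoidSum-stop n {newBlock l g}
           (trans (stop-newBlock L (s≤s⁻¹ g≤k)) (<⇒<ᵇ≡true h<g))))
         (Σ<-trim (h≤blocks L) (λ b h≤b b<k → avoidSum-stop n {l ∷ʳ b}
           (trans (stop-oldBlock L b<k) (<⇒<ᵇ≡true (s≤s h≤b))))) ⟩
  avoidSum n (newBlock l 0) + Σ< h (λ g → avoidSum n (newBlock l (suc g))) + Σ< h (λ b → avoidSum n (l ∷ʳ b))
    ≡⟨ +-assoc (avoidSum n (newBlock l 0)) _ _ ⟩
  avoidSum n (newBlock l 0) + (Σ< h (λ g → avoidSum n (newBlock l (suc g))) + Σ< h (λ b → avoidSum n (l ∷ʳ b)))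
    ≡⟨ cong₂ _+_
         (trans (avoidSum-label n (label-bottom L)) (cong (J n (suc h)) (double (blocks-newBlock (isPacked L) z≤n))))
         (trans (sym (Σ<-+ h)) (Σ<-cong h λ i i<h → cong₂ _+_
           (trans (avoidSum-label n (label-newBlock L i<h))
                  (cong (J n (suc i)) (double (blocks-newBlock (isPacked L) (≤-trans i<h (h≤blocks L))))))
           (trans (avoidSum-label n (label-oldBlock L i<h))
                  (cong (λ j → J n i (j + j)) (blocks-oldBlock (isPacked L) (<-≤-trans i<h (h≤blocks L))))))) ⟩
  J (suc n) h (k + k) ∎
  where
  open ≡-Reasoning
  k = blocks l
  double : ∀ {m} → m ≡ suc k → m + m ≡ 2 + (k + k)
  double refl = cong suc (+-suc k k)

-- The tree is entered one level above x₁, at the empty chain: label 0, no blocks, and x₁ as its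
-- only child.
Σ-WOC-blocks : ∀ n → Σ[ WOC n ] (λ l → [ not (containsStop l) ]ᵇ * (blocks l + blocks l)) ≡ J n 0 0
Σ-WOC-blocks n = trans (Σ-WOC-avoidSum n 0)
  (trans (cong (λ m → avoidSum m []) (+-identityʳ n)) (avoidSum-label n label-[]))
  where
  label-[] : Label 0 []
  label-[] = record { isPacked = packed (λ ()) (λ ()) ; h≤blocks = z≤n ; avoids = refl
                    ; threshold = λ { z≤n → refl } }

-- Counting the leaves of the restricted tree

avoidCount : ℕ → ℕ
avoidCount n = Σ[ WOC n ] (λ l → [ not (containsStop l) ]ᵇ)

stopCount : ℕ → ℕ
stopCount n = Σ[ WOC n ] (λ l → [ containsStop l ∧ not (containsStop (restrict l)) ]ᵇ)

w-Σ : ∀ n → w n ≡ avoidCount n + Σ< n (λ j → stopCount (suc j))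
w-Σ n = cong₂ _+_ (count≡Σ _ (WOC n))
  (trans (Σ-map suc (upTo n) {λ j → count _ (WOC j)})
  (trans (Σ-upTo n {λ j → count _ (WOC (suc j))}) (Σ<-cong n (λ j _ → count≡Σ _ (WOC (suc j))))))

live-split : ∀ s p → [ not (s ∨ p) ]ᵇ + [ (s ∨ p) ∧ not s ]ᵇ ≡ [ not s ]ᵇ
live-split true  p     = refl
live-split false true  = refl
live-split false false = refl

-- A child of an avoiding chain is either an avoider or a new leaf, and descendants of a containing
-- chain are neither. For a new block, `restrict` yields the parent with one rank left empty, which
-- `stop-raise` shows to be harmless.
live-child : ∀ {l c} → c ∈ children l →
             [ not (containsStop c) ]ᵇ + [ containsStop c ∧ not (containsStop (restrict c)) ]ᵇ
             ≡ [ not (containsStop l) ]ᵇ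
live-child {l} c∈ with ∈-children⁻ l c∈
... | inj₂ (b , _ , refl) rewrite stop-∷ʳ l b | init-∷ʳ l b = live-split (containsStop l) _
... | inj₁ (g , _ , refl)
  rewrite stop-∷ʳ (map (raise g) l) g | init-∷ʳ (map (raise g) l) g | stop-raise g l = live-split (containsStop l) _

avoid+stop : ∀ n → avoidCount (suc n) + stopCount (suc n) ≡ avoidCount n + J n 0 0
avoid+stop n = begin
  avoidCount (suc n) + stopCount (suc n)
    ≡⟨ sym (Σ-+ (WOC (suc n))) ⟩
  Σ[ WOC (suc n) ] live
    ≡⟨ Σ-WOC-suc n ⟩
  Σ[ WOC n ] (λ l → Σ[ children l ] live)
    ≡⟨ Σ-cong (WOC n) (λ l _ → perParent l) ⟩
  Σ[ WOC n ] (λ l → [ not (containsStop l) ]ᵇ + [ not (containsStop l) ]ᵇ * (blocks l + blocks l))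
    ≡⟨ Σ-+ (WOC n) ⟩
  avoidCount n + Σ[ WOC n ] (λ l → [ not (containsStop l) ]ᵇ * (blocks l + blocks l))
    ≡⟨ cong (avoidCount n +_) (Σ-WOC-blocks n) ⟩
  avoidCount n + J n 0 0 ∎
  where
  open ≡-Reasoning
  live : List ℕ → ℕ
  live c = [ not (containsStop c) ]ᵇ + [ containsStop c ∧ not (containsStop (restrict c)) ]ᵇ
  perParent : ∀ l → Σ[ children l ] live ≡ [ not (containsStop l) ]ᵇ + [ not (containsStop l) ]ᵇ * (blocks l + blocks l)
  perParent l = begin
    Σ[ children l ] live              ≡⟨ Σ-cong (children l) (λ c c∈ → live-child c∈) ⟩
    Σ[ children l ] (λ _ → v)         ≡⟨ Σ-children l ⟩
    Σ< (suc k) (λ _ → v) + Σ< k (λ _ → v) ≡⟨ cong₂ _+_ (Σ<-const (suc k) v) (Σ<-const k v) ⟩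
    suc k * v + k * v                 ≡⟨ +-assoc v (k * v) (k * v) ⟩
    v + (k * v + k * v)               ≡⟨ cong (v +_) (trans (sym (*-distribʳ-+ v k k)) (*-comm (k + k) v)) ⟩
    v + v * (k + k) ∎
    where
    v = [ not (containsStop l) ]ᵇ
    k = blocks l

w-suc : ∀ n → w (suc n) ≡ w n + J n 0 0
w-suc n = begin
  w (suc n)                                       ≡⟨ w-Σ (suc n) ⟩
  avoidCount (suc n) + Σ< (suc n) st               ≡⟨ cong (avoidCount (suc n) +_) (trans (Σ<-last n st) (+-comm _ (st n))) ⟩
  avoidCount (suc n) + (st n + Σ< n st)             ≡⟨ sym (+-assoc (avoidCount (suc n)) _ _) ⟩
  (avoidCount (suc n) + st n) + Σ< n st             ≡⟨ cong (_+ Σ< n st) (avoid+stop n) ⟩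
  (avoidCount n + J n 0 0) + Σ< n st               ≡⟨ +-assoc (avoidCount n) _ _ ⟩
  avoidCount n + (J n 0 0 + Σ< n st)               ≡⟨ cong (avoidCount n +_) (+-comm (J n 0 0) _) ⟩
  avoidCount n + (Σ< n st + J n 0 0)               ≡⟨ sym (+-assoc (avoidCount n) _ _) ⟩
  (avoidCount n + Σ< n st) + J n 0 0               ≡⟨ cong (_+ J n 0 0) (sym (w-Σ n)) ⟩
  w n + J n 0 0                                   ∎
  where
  open ≡-Reasoning
  st : ℕ → ℕ
  st j = stopCount (suc j)

-- Insertion of the largest entry into a permutation

insAt : ℕ → ℕ → List ℕ → List ℕ
insAt zero    x l       = x ∷ l
insAt (suc i) x []      = x ∷ []
insAt (suc i) x (a ∷ l) = a ∷ insAt i x l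

insAt-↭ : ∀ i x l → insAt i x l ↭ x ∷ l
insAt-↭ zero    x l       = ↭-refl
insAt-↭ (suc i) x []      = ↭-refl
insAt-↭ (suc i) x (a ∷ l) = ↭-trans (prep a (insAt-↭ i x l)) (swap a x ↭-refl)

insAt-++ : ∀ p x q → insAt (length p) x (p ++ q) ≡ p ++ x ∷ q
insAt-++ []      x q = refl
insAt-++ (a ∷ p) x q = cong (a ∷_) (insAt-++ p x q)

insAt-distinct : ∀ {i j x} l → x ∉ l → i < j → j ≤ length l → insAt i x l ≢ insAt j x l
insAt-distinct {zero}  {suc j} (a ∷ l) x∉ _         _         eq = x∉ (here (∷-injectiveˡ eq))
insAt-distinct {suc i} {suc j} (a ∷ l) x∉ (s<s i<j) (s≤s j≤) eq =
  insAt-distinct l (x∉ ∘ there) i<j j≤ (∷-injectiveʳ eq)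

deleteMax-none : ∀ n l → All (_< n) l → deleteMax (suc n) l ≡ l
deleteMax-none n []      []       = refl
deleteMax-none n (a ∷ l) (p ∷ ps) with a ≡ᵇ n in eq
... | true  = ⊥-elim (<-irrefl (≡ᵇ⇒≡ a n (≡true⇒T eq)) p)
... | false = cong (a ∷_) (deleteMax-none n l ps)

deleteMax-insAt : ∀ i n l → All (_< n) l → deleteMax (suc n) (insAt i n l) ≡ l
deleteMax-insAt zero n l ps with n ≡ᵇ n in eq
... | true  = deleteMax-none n l ps
... | false = ⊥-elim (subst T eq (≡⇒≡ᵇ n n refl))
deleteMax-insAt (suc i) n [] [] with n ≡ᵇ n in eq
... | true  = refl
... | false = ⊥-elim (subst T eq (≡⇒≡ᵇ n n refl))
deleteMax-insAt (suc i) n (a ∷ l) (p ∷ ps) with a ≡ᵇ n in eq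
... | true  = ⊥-elim (<-irrefl (≡ᵇ⇒≡ a n (≡true⇒T eq)) p)
... | false = cong (a ∷_) (deleteMax-insAt i n l ps)

distinct⁺ : ∀ {l} → Unique l → distinct l ≡ true
distinct⁺ {[]}    _ = refl
distinct⁺ {a ∷ l} u@(_ ∷ ul) with elemᵇ a l in eq
... | true  = ⊥-elim (Unique[x∷xs]⇒x∉xs u (elemᵇ⁻ a l eq))
... | false = distinct⁺ ul

distinct⁻ : ∀ l → distinct l ≡ true → Unique l
distinct⁻ []      _  = []
distinct⁻ (a ∷ l) eq with elemᵇ a l in eqₑ
... | false = All.tabulate (λ {b} b∈ a≡b → true≢false (trans (sym (elemᵇ⁺ (subst (_∈ l) (sym a≡b) b∈))) eqₑ)) ∷ distinct⁻ l eq
  where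
  true≢false : true ≢ false
  true≢false ()

record IsPerm (n : ℕ) (l : List ℕ) : Set where
  constructor perm
  field
    size     : length l ≡ n
    entries  : All (_< n) l
    distinctEntries : Unique l
open IsPerm

∈-Perms⁺ : ∀ {n l} → IsPerm n l → l ∈ Perms n
∈-Perms⁺ {l = l} (perm refl bnd u) =
  ∈-filter⁺ (λ σ → T? (distinct σ)) (∈-words⁺ l bnd) (≡true⇒T (distinct⁺ u))

∈-Perms⁻ : ∀ n {l} → l ∈ Perms n → IsPerm n l
∈-Perms⁻ n {l} l∈ with l∈w , t ← ∈-filter⁻ (λ σ → T? (distinct σ)) {xs = words n n} l∈
  with len , bnd ← ∈-words⁻ n l∈w = perm len bnd (distinct⁻ l (T⇒≡true t))

max∉ : ∀ {n l} → All (_< n) l → n ∉ l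
max∉ bnd n∈ = <-irrefl refl (All.lookup bnd n∈)

isPerm-insAt : ∀ i {n l} → IsPerm n l → IsPerm (suc n) (insAt i n l)
isPerm-insAt i {n} {l} (perm len bnd u) = perm
  (trans (↭.↭-length (insAt-↭ i n l)) (cong suc len))
  (↭.All-resp-↭ (↭-sym (insAt-↭ i n l)) (n<1+n n ∷ All.map (λ p → <-trans p (n<1+n n)) bnd))
  (↭ₛ.Unique-resp-↭ (setoid ℕ) (↭⇒↭ₛ (↭-sym (insAt-↭ i n l)))
    (All.map (λ p n≡ → <-irrefl (sym n≡) p) bnd ∷ u))

insertions : ℕ → List ℕ → List (List ℕ)
insertions n l = map (λ i → insAt i n l) (upTo (suc n))

Perms⊆insertions : ∀ n {σ} → IsPerm (suc n) σ → σ ∈ concatMap (insertions n) (Perms n)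
Perms⊆insertions n {σ} (perm len bnd u) with n ∈? σ
-- Pigeonhole: without `n`, the `suc n` distinct entries would all lie below `n`.
... | no n∉ = ⊥-elim (<-irrefl refl (subst₂ _≤_ len (length-upTo n) (unique-⊆-length u below)))
  where
  below : ∀ {v} → v ∈ σ → v ∈ upTo n
  below {v} v∈ = ∈-upTo⁺ (≤∧≢⇒< (s≤s⁻¹ (All.lookup bnd v∈)) λ { refl → n∉ v∈ })
... | yes n∈ with p , q , refl ← ∈-∃++ n∈ = ∈-concatMap⁺ (insertions n) (lose (∈-Perms⁺ isPerm)
      (subst (_∈ insertions n (p ++ q)) (insAt-++ p n q)
        (∈-map⁺ (λ i → insAt i n (p ++ q)) (∈-upTo⁺ (s≤s p≤n)))))
  where
  moved : p ++ n ∷ q ↭ n ∷ (p ++ q)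
  moved = ↭.shift n p q
  u′ : Unique (n ∷ (p ++ q))
  u′ = ↭ₛ.Unique-resp-↭ (setoid ℕ) (↭⇒↭ₛ moved) u
  len′ : length (p ++ q) ≡ n
  len′ = suc-injective (trans (sym (↭.↭-length moved)) len)
  p≤n : length p ≤ n
  p≤n = subst (length p ≤_) (trans (sym (length-++ p)) len′) (m≤m+n (length p) (length q))
  isPerm : IsPerm n (p ++ q)
  isPerm with _ ∷ u″ ← u′ | _ ∷ bnd′ ← ↭.All-resp-↭ moved bnd = perm len′
    (All.tabulate λ {v} v∈ → ≤∧≢⇒< (s≤s⁻¹ (All.lookup bnd′ v∈)) λ v≡n →
      Unique[x∷xs]⇒x∉xs u′ (subst (_∈ p ++ q) v≡n v∈)) u″

Perms-unique : ∀ n → Unique (Perms n)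
Perms-unique n = filter⁺ (λ σ → T? (distinct σ)) (words-unique n n)

insertions-unique : ∀ {n l} → IsPerm n l → Unique (insertions n l)
insertions-unique {n} {l} (perm len bnd u) = subst Unique (sym (map-upTo (λ i → insAt i n l) (suc n)))
  (applyUpTo⁺₁ (λ i → insAt i n l) (suc n)
    (λ i<j j<n → insAt-distinct l (max∉ bnd) i<j (subst (_ ≤_) (sym len) (s≤s⁻¹ j<n))))

Perms-suc : ∀ n → Perms (suc n) ↭ concatMap (insertions n) (Perms n)
Perms-suc n = unique-sameElements-↭ (Perms-unique (suc n))
  (unique-concatMap (insertions n) (deleteMax (suc n)) (Perms-unique n)
    (insertions-unique ∘ ∈-Perms⁻ n) delete)
  (Perms⊆insertions n ∘ ∈-Perms⁻ (suc n))
  (λ σ∈ → let l , l∈ , σ∈l = find (∈-concatMap⁻ (insertions n) {xs = Perms n} σ∈)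
              i , _ , eq = ∈-map⁻ (λ i → insAt i n l) {xs = upTo (suc n)} σ∈l
          in ∈-Perms⁺ (subst (IsPerm (suc n)) (sym eq) (isPerm-insAt i (∈-Perms⁻ n l∈))))
  where
  delete : ∀ {l σ} → l ∈ Perms n → σ ∈ insertions n l → deleteMax (suc n) σ ≡ l
  delete {l} l∈ σ∈ with i , _ , refl ← ∈-map⁻ (λ i → insAt i n l) {xs = upTo (suc n)} σ∈ =
    deleteMax-insAt i n l (entries (∈-Perms⁻ n l∈))

Σ-Perms-suc : ∀ n {f : List ℕ → ℕ} →
              Σ[ Perms (suc n) ] f ≡ Σ[ Perms n ] (λ l → Σ< (suc n) (λ i → f (insAt i n l)))
Σ-Perms-suc n {f} = trans (Σ-↭ (Perms-suc n)) (trans (Σ-concatMap (insertions n) (Perms n))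
  (Σ-cong (Perms n) (λ l _ → trans (Σ-map (λ i → insAt i n l) (upTo (suc n)) {f})
                                    (Σ-upTo (suc n) {λ i → f (insAt i n l)}))))

-- Ascents, descents and the initial decreasing run

asc : List ℕ → ℕ
asc []          = 0
asc (a ∷ [])    = 0
asc (a ∷ b ∷ l) = (if b <ᵇ a then 0 else 1) + asc (b ∷ l)

des : List ℕ → ℕ
des []          = 0
des (a ∷ [])    = 0
des (a ∷ b ∷ l) = [ b <ᵇ a ]ᵇ + des (b ∷ l)

asc+des : ∀ a l → suc (asc (a ∷ l) + des (a ∷ l)) ≡ length (a ∷ l)
asc+des a []      = refl
asc+des a (b ∷ l) with b <ᵇ a
... | true  = trans (cong suc (+-suc (asc (b ∷ l)) _)) (cong suc (asc+des b l))
... | false = cong suc (asc+des b l)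

-- Stated for every `adj` and `p` with the right equations, because the ones inside `descents` are
-- local to it.
count-des : (adj : List ℕ → List (ℕ × ℕ)) (p : ℕ × ℕ → Bool) →
            adj [] ≡ [] → (∀ a → adj (a ∷ []) ≡ []) →
            (∀ a b l → adj (a ∷ b ∷ l) ≡ (a , b) ∷ adj (b ∷ l)) →
            (∀ a b → p (a , b) ≡ (b <ᵇ a)) → ∀ l → count p (adj l) ≡ des l
count-des adj p e₀ e₁ e₂ ep []          = cong (count p) e₀
count-des adj p e₀ e₁ e₂ ep (a ∷ [])    = cong (count p) (e₁ a)
count-des adj p e₀ e₁ e₂ ep (a ∷ b ∷ l) = begin
  count p (adj (a ∷ b ∷ l))                                  ≡⟨ cong (count p) (e₂ a b l) ⟩
  count p ((a , b) ∷ adj (b ∷ l))                            ≡⟨ count≡Σ p ((a , b) ∷ adj (b ∷ l)) ⟩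
  [ p (a , b) ]ᵇ + Σ[ adj (b ∷ l) ] (λ x → [ p x ]ᵇ)         ≡⟨ cong₂ (λ t s → [ t ]ᵇ + s) (ep a b)
    (trans (sym (count≡Σ p (adj (b ∷ l)))) (count-des adj p e₀ e₁ e₂ ep (b ∷ l))) ⟩
  des (a ∷ b ∷ l) ∎
  where open ≡-Reasoning

-- The underscore stands for the where-local list of adjacent pairs of descents.
mutual
  localAdj : List ℕ → List ℕ → List (ℕ × ℕ)
  localAdj = _

  descents-step : ∀ a b l → descents (a ∷ b ∷ l) ≡ [ b <ᵇ a ]ᵇ + des (b ∷ l)
  descents-step a b l with b List.∷ l | a List.∷ b List.∷ l
  ... | m | o = trans (count≡Σ (λ (a , b) → b <ᵇ a) ((a , b) ∷ localAdj o m)) (cong ([ b <ᵇ a ]ᵇ +_)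
    (trans (sym (count≡Σ (λ (a , b) → b <ᵇ a) (localAdj o m)))
      (count-des (localAdj o) (λ (a , b) → b <ᵇ a) refl (λ _ → refl) (λ _ _ _ → refl) (λ _ _ → refl) m)))

descents≡des : ∀ l → descents l ≡ des l
descents≡des []          = refl
descents≡des (a ∷ [])    = refl
descents≡des (a ∷ b ∷ l) = descents-step a b l

run : List ℕ → ℕ
run []          = 0
run (a ∷ [])    = 1
run (a ∷ b ∷ l) = if b <ᵇ a then suc (run (b ∷ l)) else 1

run-positive : ∀ a l → 0 < run (a ∷ l)
run-positive a []      = z<s
run-positive a (b ∷ l) with b <ᵇ a
... | true  = z<s
... | false = z<s

asc-insAt-first : ∀ {x a} l → a < x → asc (x ∷ a ∷ l) ≡ asc (a ∷ l)
asc-insAt-first l a<x rewrite <⇒<ᵇ≡true a<x = refl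

run-insAt-first : ∀ {x a} l → a < x → run (x ∷ a ∷ l) ≡ suc (run (a ∷ l))
run-insAt-first l a<x rewrite <⇒<ᵇ≡true a<x = refl

run-insAt : ∀ i {x} l → All (_< x) l → 0 < i → i ≤ run l → run (insAt i x l) ≡ i
run-insAt (suc i)       []          _        _ ()
run-insAt (suc zero)    (a ∷ [])    (p ∷ _)  _ _ rewrite ≥⇒<ᵇ≡false (<⇒≤ p) = refl
run-insAt (suc (suc i)) (a ∷ [])    _        _ (s≤s ())
run-insAt (suc zero)    (a ∷ b ∷ l) (p ∷ _)  _ _ rewrite ≥⇒<ᵇ≡false (<⇒≤ p) = refl
run-insAt (suc (suc i)) (a ∷ b ∷ l) (_ ∷ ps) _ i≤ with b <ᵇ a
... | true  = cong suc (run-insAt (suc i) (b ∷ l) ps z<s (s≤s⁻¹ i≤))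
... | false with s≤s () ← i≤

-- A gap inside the run is a descent; the maximum replaces it by an ascent followed by a descent.
asc-insAt-inside : ∀ i {x} l → All (_< x) l → 0 < i → i < run l → asc (insAt i x l) ≡ suc (asc l)
asc-insAt-inside (suc i)       []          _            _ ()
asc-insAt-inside (suc i)       (a ∷ [])    _            _ (s≤s ())
asc-insAt-inside (suc zero)    (a ∷ b ∷ l) (p ∷ q ∷ _)  _ i<
  rewrite ≥⇒<ᵇ≡false (<⇒≤ p) | <⇒<ᵇ≡true q with b <ᵇ a
... | true = refl
... | false with s≤s () ← i<
asc-insAt-inside (suc (suc i)) (a ∷ b ∷ l) (_ ∷ ps)     _ i< with b <ᵇ a
... | true  = asc-insAt-inside (suc i) (b ∷ l) ps z<s (s≤s⁻¹ i<)
... | false with s≤s () ← i<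

asc-insAt-last : ∀ {x} a l → All (_< x) (a ∷ l) → asc (insAt (suc (length l)) x (a ∷ l)) ≡ suc (asc (a ∷ l))
asc-insAt-last a []      (p ∷ _)  rewrite ≥⇒<ᵇ≡false (<⇒≤ p) = refl
asc-insAt-last a (b ∷ l) (_ ∷ ps) =
  trans (cong ((if b <ᵇ a then 0 else 1) +_) (asc-insAt-last b l ps)) (+-suc _ _)

asc-∷-insAt : ∀ {d} a b x l → 0 < d →
              asc (a ∷ insAt d x (b ∷ l)) ≡ (if b <ᵇ a then 0 else 1) + asc (insAt d x (b ∷ l))
asc-∷-insAt {suc d} a b x l _ = refl

-- The gap just after the run is an ascent already; the maximum turns it into an ascent and a
-- descent, so only a descent is gained.
asc-insAt-run : ∀ {x} a l → All (_< x) (a ∷ l) → run (a ∷ l) < length (a ∷ l) →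
               asc (insAt (run (a ∷ l)) x (a ∷ l)) ≡ asc (a ∷ l)
asc-insAt-run a []      _            (s≤s ())
asc-insAt-run {x} a (b ∷ l) (p ∷ q ∷ ps) run< with b <ᵇ a in eq
... | true  = trans (asc-∷-insAt a b x l (run-positive b l))
                (trans (cong (λ t → (if t then 0 else 1) + asc (insAt (run (b ∷ l)) x (b ∷ l))) eq)
                       (asc-insAt-run b l (q ∷ ps) (s≤s⁻¹ run<)))
... | false rewrite ≥⇒<ᵇ≡false (<⇒≤ p) | <⇒<ᵇ≡true q = refl

run-full : ∀ a l → run (a ∷ l) ≡ length (a ∷ l) → asc (a ∷ l) ≡ 0
run-full a []      _ = refl
run-full a (b ∷ l) eq with b <ᵇ a
... | true  = run-full b l (suc-injective eq)
... | false with () ← eq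

des-insAt-≤ : ∀ i {x} l → All (_< x) l → des l ≤ des (insAt i x l)
des-insAt-≤ zero          []          _            = z≤n
des-insAt-≤ zero {x}      (a ∷ l)     _            = m≤n+m _ [ a <ᵇ x ]ᵇ
des-insAt-≤ (suc i)       []          _            = z≤n
des-insAt-≤ (suc i)       (a ∷ [])    _            = z≤n
des-insAt-≤ (suc zero)    (a ∷ b ∷ l) (p ∷ q ∷ _)
  rewrite ≥⇒<ᵇ≡false (<⇒≤ p) | <⇒<ᵇ≡true q with b <ᵇ a
... | true  = ≤-refl
... | false = n≤1+n _
des-insAt-≤ (suc (suc i)) (a ∷ b ∷ l) (_ ∷ ps)     = +-monoʳ-≤ [ b <ᵇ a ]ᵇ (des-insAt-≤ (suc i) (b ∷ l) ps)

-- For nonempty `l`, one more than this is twice the mean number of blocks of the chains listed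
-- along `l`: 2 + 2 des + asc, with asc + des + 1 the length.
len+des : List ℕ → ℕ
len+des l = length l + des l

-- The maximum doubles the weight in a descent gap or at the end and keeps it in an ascent gap,
-- giving the factor asc + 2 (des + 1), which is `suc (len+des (a ∷ l))`. The front position is left
-- out so that the induction can keep `a` at the head.
Σ-2^asc-tail : ∀ {x} a l → All (_< x) (a ∷ l) →
               Σ< (suc (length l)) (λ i → 2 ^ asc (a ∷ insAt i x l)) ≡ 2 ^ asc (a ∷ l) * suc (len+des (a ∷ l))
Σ-2^asc-tail a []          (p ∷ _)      rewrite ≥⇒<ᵇ≡false (<⇒≤ p) = refl
Σ-2^asc-tail {x} a (b ∷ l) (p ∷ q ∷ ps) rewrite ≥⇒<ᵇ≡false (<⇒≤ p) | <⇒<ᵇ≡true q with b <ᵇ a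
... | true  = trans (cong (2 * A +_) (Σ-2^asc-tail b l (q ∷ ps)))
                (solve 3 (λ A n d → con 2 :* A :+ A :* (con 1 :+ ((con 1 :+ n) :+ d))
                                 := A :* (con 1 :+ ((con 2 :+ n) :+ (con 1 :+ d)))) refl A (length l) (des (b ∷ l)))
  where
  open +-*-Solver
  A = 2 ^ asc (b ∷ l)
... | false = trans (cong (2 * A +_) (trans (Σ<-* 2 (suc (length l)) {λ i → 2 ^ asc (b ∷ insAt i x l)}) (cong (2 *_) (Σ-2^asc-tail b l (q ∷ ps)))))
                (solve 3 (λ A n d → con 2 :* A :+ con 2 :* (A :* (con 1 :+ ((con 1 :+ n) :+ d)))
                                 := (con 2 :* A) :* (con 1 :+ ((con 2 :+ n) :+ d))) refl A (length l) (des (b ∷ l)))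
  where
  open +-*-Solver
  A = 2 ^ asc (b ∷ l)

Σ-2^asc : ∀ {x} a l → All (_< x) (a ∷ l) →
          Σ< (suc (length (a ∷ l))) (λ i → 2 ^ asc (insAt i x (a ∷ l))) ≡ 2 ^ asc (a ∷ l) * (2 + len+des (a ∷ l))
Σ-2^asc a l ps@(p ∷ _) = trans (cong₂ _+_ (cong (2 ^_) (asc-insAt-first l p)) (Σ-2^asc-tail a l ps))
                               (sym (*-suc (2 ^ asc (a ∷ l)) _))

-- Occurrences of 123

c123 : List ℕ → Bool
c123 = anyTriple (λ a b c → (a <ᵇ b) ∧ (b <ᵇ c))

contains123≡c123 : ∀ l → contains123 l ≡ c123 l
contains123≡c123 l = any-triples _ l

any-insAt : (q : ℕ → Bool) → ∀ i x l → any q (insAt i x l) ≡ any q l ∨ q x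
any-insAt q zero    x l       = ∨-comm (q x) _
any-insAt q (suc i) x []      = ∨-identityʳ (q x)
any-insAt q (suc i) x (a ∷ l) = trans (cong (q a ∨_) (any-insAt q i x l)) (sym (∨-assoc (q a) _ _))

anyPair-insAt : (q : ℕ → ℕ → Bool) → ∀ i x l → (∀ {c} → c ∈ l → q x c ≡ false) →
                anyPair q (insAt i x l) ≡ anyPair q l ∨ any (λ b → q b x) (take i l)
anyPair-insAt q zero    x l       vanish = trans (cong (_∨ anyPair q l) (any-none (q x) l vanish)) (sym (∨-identityʳ _))
anyPair-insAt q (suc i) x []      vanish = refl
anyPair-insAt q (suc i) x (a ∷ l) vanish =
  trans (cong₂ _∨_ (any-insAt (q a) i x l) (anyPair-insAt q i x l (vanish ∘ there)))
        (∨-interchange (any (q a) l) _ _ _)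

anyPair-none : (q : ℕ → ℕ → Bool) → ∀ l → (∀ {b} c → b ∈ l → q b c ≡ false) → anyPair q l ≡ false
anyPair-none q []      vanish = refl
anyPair-none q (a ∷ l) vanish = cong₂ _∨_ (any-none (q a) l (λ {c} _ → vanish c (here refl)))
                                      (anyPair-none q l (λ c → vanish c ∘ there))

-- The two vanishing conditions hold for 123 and a largest `x`: it can only be the last entry of an
-- occurrence, so only the pairs in front of it matter.
anyTriple-insAt : (p : ℕ → ℕ → ℕ → Bool) → ∀ i x l → (∀ {b} c → b ∈ l → p x b c ≡ false) →
                  (∀ a {c} → c ∈ l → p a x c ≡ false) →
                  anyTriple p (insAt i x l) ≡ anyTriple p l ∨ anyPair (λ a b → p a b x) (take i l)
anyTriple-insAt p zero    x l       vanish₁ vanish₂ =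
  trans (cong (_∨ anyTriple p l) (anyPair-none (p x) l vanish₁)) (sym (∨-identityʳ _))
anyTriple-insAt p (suc i) x []      vanish₁ vanish₂ = refl
anyTriple-insAt p (suc i) x (a ∷ l) vanish₁ vanish₂ =
  trans (cong₂ _∨_ (anyPair-insAt (p a) i x l (vanish₂ a ∘ there))
                   (anyTriple-insAt p i x l (λ c → vanish₁ c ∘ there) (λ a → vanish₂ a ∘ there)))
        (∨-interchange (anyPair (p a) l) _ _ _)

anyPair-∈-cong : {p q : ℕ → ℕ → Bool} → ∀ l → (∀ a {b} → b ∈ l → p a b ≡ q a b) → anyPair p l ≡ anyPair q l
anyPair-∈-cong []      eq = refl
anyPair-∈-cong {p} {q} (a ∷ l) eq = cong₂ _∨_ (go l (λ b∈ → eq a (there b∈))) (anyPair-∈-cong l (λ a b∈ → eq a (there b∈)))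
  where
  go : ∀ m → (∀ {b} → b ∈ m → p a b ≡ q a b) → any (p a) m ≡ any (q a) m
  go []      _  = refl
  go (b ∷ m) eq = cong₂ _∨_ (eq (here refl)) (go m (eq ∘ there))

take-⊆ : ∀ i (l : List ℕ) {v} → v ∈ take i l → v ∈ l
take-⊆ (suc i) (a ∷ l) (here p)  = here p
take-⊆ (suc i) (a ∷ l) (there p) = there (take-⊆ i l p)

run-bounded : ∀ i b l → i ≤ run (b ∷ l) → ∀ {v} → v ∈ take i (b ∷ l) → v ≤ b
run-bounded (suc i) b l       _  (here refl) = ≤-refl
run-bounded (suc (suc i)) b (c ∷ l) i≤ (there v∈) with c <ᵇ b in eq
... | true  = ≤-trans (run-bounded (suc i) c l (s≤s⁻¹ i≤) v∈) (<⇒≤ (<ᵇ⇒< c b (≡true⇒T eq)))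
... | false with s≤s () ← i≤

take-ascent : ∀ i l → Unique l → i ≤ length l → anyPair _<ᵇ_ (take i l) ≡ (run l <ᵇ i)
take-ascent zero    l           _        _  = refl
take-ascent (suc zero)    (a ∷ [])    _  _  = refl
take-ascent (suc (suc i)) (a ∷ [])    _  (s≤s ())
take-ascent (suc zero)    (a ∷ b ∷ l) _  _ with b <ᵇ a
... | true  = refl
... | false = refl
take-ascent (suc (suc i)) (a ∷ b ∷ l) (u ∷ us) (s≤s i≤) with b <ᵇ a in eq
... | false = cong (λ t → (t ∨ any (a <ᵇ_) (take i l)) ∨ anyPair _<ᵇ_ (b ∷ take i l)) (<⇒<ᵇ≡true a<b)
  where
  a<b : a < b
  a<b = ≤∧≢⇒< (≮⇒≥ λ b<a → subst T eq (<⇒<ᵇ b<a)) (All.head u)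
... | true with run (b ∷ l) <? suc i
...   | yes d<i = trans (cong (any (a <ᵇ_) (take (suc i) (b ∷ l)) ∨_)
                      (trans (take-ascent (suc i) (b ∷ l) us i≤) (<⇒<ᵇ≡true d<i)))
                    (trans (∨-zeroʳ _) (sym (<⇒<ᵇ≡true d<i)))
...   | no d≮i = trans (cong₂ _∨_
                      (any-none (a <ᵇ_) (take (suc i) (b ∷ l)) (λ v∈ → ≥⇒<ᵇ≡false
                        (≤-trans (run-bounded (suc i) b l (≮⇒≥ d≮i) v∈) (<⇒≤ (<ᵇ⇒< b a (≡true⇒T eq))))))
                      (trans (take-ascent (suc i) (b ∷ l) us i≤) (≥⇒<ᵇ≡false (≮⇒≥ d≮i))))
                    (sym (≥⇒<ᵇ≡false (≮⇒≥ d≮i)))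

-- The maximum completes a 123 exactly when an ascent precedes it, that is, when it is placed beyond
-- the initial decreasing run. The run is thus the counterpart of the label.
c123-insAt : ∀ i {x} l → All (_< x) l → Unique l → i ≤ length l → c123 (insAt i x l) ≡ c123 l ∨ (run l <ᵇ i)
c123-insAt i {x} l bnd u i≤ = trans
  (anyTriple-insAt _ i x l
    (λ {b} c b∈ → cong (_∧ (b <ᵇ c)) (≥⇒<ᵇ≡false (<⇒≤ (All.lookup bnd b∈))))
    (λ a {c} c∈ → trans (cong ((a <ᵇ x) ∧_) (≥⇒<ᵇ≡false (<⇒≤ (All.lookup bnd c∈)))) (∧-zeroʳ _)))
  (cong (c123 l ∨_) (trans
    (anyPair-∈-cong (take i l) (λ a {b} b∈ → trans (cong ((a <ᵇ b) ∧_) (<⇒<ᵇ≡true (All.lookup bnd (take-⊆ i l b∈)))) (∧-identityʳ _)))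
    (take-ascent i l u i≤)))

-- Weighted descendants of a 123-avoiding permutation

-- The argument `c` is only passed on with constants added and summed at the end, so `J n h` is
-- affine in it. The midpoint form states this without subtraction.
J-affine : ∀ n h c → J n h (2 + c) + J n h c ≡ 2 * J n h (1 + c)
J-affine zero    h c = solve 1 (λ c → (con 2 :+ c) :+ c := con 2 :* (con 1 :+ c)) refl c
  where open +-*-Solver
J-affine (suc n) h c = begin
  (J n (suc h) (4 + c) + Σ< h (F (2 + c))) + (J n (suc h) (2 + c) + Σ< h (F c))
    ≡⟨ +-interchange (J n (suc h) (4 + c)) _ _ _ ⟩
  (J n (suc h) (4 + c) + J n (suc h) (2 + c)) + (Σ< h (F (2 + c)) + Σ< h (F c))
    ≡⟨ cong₂ _+_ (J-affine n (suc h) (2 + c)) (trans (sym (Σ<-+ h)) (Σ<-cong h λ i _ → pointwise i)) ⟩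
  2 * J n (suc h) (3 + c) + Σ< h (λ i → 2 * F (1 + c) i)
    ≡⟨ cong (2 * J n (suc h) (3 + c) +_) (Σ<-* 2 h) ⟩
  2 * J n (suc h) (3 + c) + 2 * Σ< h (F (1 + c))
    ≡⟨ sym (*-distribˡ-+ 2 (J n (suc h) (3 + c)) _) ⟩
  2 * J (suc n) h (1 + c) ∎
  where
  open ≡-Reasoning
  F : ℕ → ℕ → ℕ
  F c i = J n (suc i) (2 + c) + J n i c
  pointwise : ∀ i → F (2 + c) i + F c i ≡ 2 * F (1 + c) i
  pointwise i = trans (+-interchange (J n (suc i) (4 + c)) _ _ _)
    (trans (cong₂ _+_ (J-affine n (suc i) (2 + c)) (J-affine n i c)) (sym (*-distribˡ-+ 2 (J n (suc i) (3 + c)) _)))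

permSum : ℕ → List ℕ → ℕ
permSum zero    l = [ not (c123 l) ]ᵇ * (2 ^ asc l * suc (len+des l))
permSum (suc n) l = Σ< (suc (length l)) (λ i → permSum n (insAt i (length l) l))

∨-true : ∀ {a b} → a ≡ true → a ∨ b ≡ true
∨-true refl = refl

isPerm-child : ∀ i {l} → IsPerm (length l) l → IsPerm (length (insAt i (length l) l)) (insAt i (length l) l)
isPerm-child i {l} p = subst (λ m → IsPerm m (insAt i (length l) l)) (sym (size q)) q
  where q = isPerm-insAt i p

length-insAt : ∀ i x l → length (insAt i x l) ≡ suc (length l)
length-insAt i x l = ↭.↭-length (insAt-↭ i x l)

permSum-c123 : ∀ n {l} → IsPerm (length l) l → c123 l ≡ true → permSum n l ≡ 0
permSum-c123 zero    {l} p c = cong (λ t → [ not t ]ᵇ * (2 ^ asc l * suc (len+des l))) c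
permSum-c123 (suc n) {l} p c = trans (Σ<-cong (suc (length l)) (λ i i≤ → permSum-c123 n (isPerm-child i p)
  (trans (c123-insAt i l (entries p) (distinctEntries p) (s≤s⁻¹ i≤)) (∨-true c)))) (Σ<-0 (suc (length l)))

avoids-child : ∀ i {l} → IsPerm (length l) l → c123 l ≡ false → i ≤ run l → i ≤ length l →
               c123 (insAt i (length l) l) ≡ false
avoids-child i {l} p c i≤ i≤len = trans (c123-insAt i l (entries p) (distinctEntries p) i≤len)
  (cong₂ _∨_ c (≥⇒<ᵇ≡false i≤))

asc+len+des : ∀ l → 0 < length l → suc (asc l + len+des l) ≡ length l + length l
asc+len+des (a ∷ l) _ = begin
  suc (asc (a ∷ l) + (length (a ∷ l) + des (a ∷ l)))
    ≡⟨ solve 3 (λ x y z → con 1 :+ (x :+ (y :+ z)) := y :+ (con 1 :+ (x :+ z))) refl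
         (asc (a ∷ l)) (length (a ∷ l)) (des (a ∷ l)) ⟩
  length (a ∷ l) + suc (asc (a ∷ l) + des (a ∷ l))
    ≡⟨ cong (length (a ∷ l) +_) (asc+des a l) ⟩
  length (a ∷ l) + length (a ∷ l) ∎
  where
  open ≡-Reasoning
  open +-*-Solver

-- Since asc + des + 1 is the length, one more entry raises asc + `len+des` by two; whatever the
-- ascents do not take goes to `len+des`.
len+des-insAt : ∀ i {x} l k k′ → 0 < length l → asc (insAt i x l) ≡ k + asc l → k + k′ ≡ 2 →
                len+des (insAt i x l) ≡ k′ + len+des l
len+des-insAt i {x} l k k′ 0<l eq k+k′ = +-cancelˡ-≡ (suc (asc σ)) _ _ (begin
  suc (asc σ + len+des σ)                ≡⟨ asc+len+des σ (subst (0 <_) (sym lenσ) z<s) ⟩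
  length σ + length σ                    ≡⟨ cong (λ m → m + m) lenσ ⟩
  suc (length l) + suc (length l)        ≡⟨ cong suc (+-suc (length l) (length l)) ⟩
  2 + (length l + length l)              ≡⟨ cong₂ _+_ (sym k+k′) (sym (asc+len+des l 0<l)) ⟩
  (k + k′) + suc (asc l + len+des l)
    ≡⟨ solve 4 (λ k k′ a e → (k :+ k′) :+ (con 1 :+ (a :+ e)) := (con 1 :+ (k :+ a)) :+ (k′ :+ e)) refl
         k k′ (asc l) (len+des l) ⟩
  suc (k + asc l) + (k′ + len+des l)     ≡⟨ cong (λ m → suc m + (k′ + len+des l)) (sym eq) ⟩
  suc (asc σ) + (k′ + len+des l) ∎)
  where
  open ≡-Reasoning
  open +-*-Solver
  σ = insAt i x l
  lenσ = length-insAt i x l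

-- Fixing the order and equality signs of a chain listed along π at random, the first
-- ascent of π at position H is < (label H) or = (label H - 1) equally often: hence the average.
permSum-mixed : ∀ n {l H} → IsPerm (length l) l → c123 l ≡ false → run l ≡ suc H → suc H < length l →
                2 * permSum n l ≡ 2 ^ asc l * (J n (suc H) (2 + len+des l) + J n H (len+des l))
permSum-mixed zero {l} p c _ _ rewrite c =
  solve 2 (λ A e → con 2 :* (A :* (con 1 :+ e) :+ con 0) := A :* ((con 2 :+ e) :+ e)) refl (2 ^ asc l) (len+des l)
  where open +-*-Solver
permSum-mixed (suc n) {l@(a ∷ l′)} {H} p c run≡ run< = begin
  2 * Σ< (suc m) f
    ≡⟨ cong (2 *_) (Σ<-trim (<⇒≤ (s≤s run<)) (λ i H<i i≤ → permSum-c123 n (isPerm-child i p)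
         (trans (c123-insAt i l (entries p) (distinctEntries p) (s≤s⁻¹ i≤))
                (trans (cong (c123 l ∨_) (<⇒<ᵇ≡true (subst (_< i) (sym run≡) H<i))) (∨-zeroʳ _))))) ⟩
  2 * (f 0 + Σ< (suc H) (f ∘ suc))
    ≡⟨ cong (λ s → 2 * (f 0 + s)) (Σ<-last H (f ∘ suc)) ⟩
  2 * (f 0 + (Σ< H (f ∘ suc) + f (suc H)))
    ≡⟨ solve 3 (λ x y z → con 2 :* (x :+ (y :+ z)) := con 2 :* x :+ (con 2 :* y :+ con 2 :* z)) refl
         (f 0) (Σ< H (f ∘ suc)) (f (suc H)) ⟩
  2 * f 0 + (2 * Σ< H (f ∘ suc) + 2 * f (suc H))
    -- The result holds the recursions of `J` at labels `suc H` and `H`. The former has one more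
    -- summand, `i = H`, and the position right after the run supplies it.
    ≡⟨ cong₂ _+_ first (cong₂ _+_ inner last) ⟩
  A * (J n (2 + H) (4 + e₀) + J n (suc H) (2 + e₀))
    + (A * (Σ< H (G (2 + e₀)) + Σ< H (G e₀)) + A * (J n (suc H) (4 + e₀) + J n H (2 + e₀)))
    ≡⟨ solve 7 (λ A a b c d s t → A :* (a :+ b) :+ (A :* (s :+ t) :+ A :* (c :+ d))
                               := A :* ((a :+ (s :+ (c :+ d))) :+ (b :+ t))) refl
         A (J n (2 + H) (4 + e₀)) (J n (suc H) (2 + e₀)) (J n (suc H) (4 + e₀)) (J n H (2 + e₀))
         (Σ< H (G (2 + e₀))) (Σ< H (G e₀)) ⟩
  A * ((J n (2 + H) (4 + e₀) + (Σ< H (G (2 + e₀)) + G (2 + e₀) H)) + J (suc n) H e₀)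
    ≡⟨ cong (λ s → A * ((J n (2 + H) (4 + e₀) + s) + J (suc n) H e₀)) (sym (Σ<-last H (G (2 + e₀)))) ⟩
  A * (J (suc n) (suc H) (2 + e₀) + J (suc n) H e₀) ∎
  where
  open ≡-Reasoning
  open +-*-Solver
  m  = length l
  e₀ = len+des l
  A  = 2 ^ asc l
  f : ℕ → ℕ
  f i = permSum n (insAt i m l)
  G : ℕ → ℕ → ℕ
  G c i = J n (suc i) (2 + c) + J n i c
  bnd : All (_< m) l
  bnd = entries p
  i≤len : ∀ {i} → i ≤ suc H → i ≤ m
  i≤len i≤ = ≤-trans i≤ (<⇒≤ run<)
  child : ∀ i k k′ {H′} → i ≤ suc H → asc (insAt i m l) ≡ k + asc l → k + k′ ≡ 2 →
          run (insAt i m l) ≡ suc H′ → H′ ≤ suc H →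
          2 * f i ≡ 2 ^ (k + asc l) * (J n (suc H′) (2 + (k′ + e₀)) + J n H′ (k′ + e₀))
  child i k k′ {H′} i≤ asc≡ k+k′ runσ H′≤ = trans
    (permSum-mixed n (isPerm-child i p) (avoids-child i p c (subst (i ≤_) (sym run≡) i≤) (i≤len i≤)) runσ
      (subst (suc H′ <_) (sym (length-insAt i m l)) (s<s (<-≤-trans (s≤s H′≤) run<))))
    (cong₂ (λ u v → 2 ^ u * (J n (suc H′) (2 + v) + J n H′ v)) asc≡ (len+des-insAt i l k k′ z<s asc≡ k+k′))
  first : 2 * f 0 ≡ A * (J n (2 + H) (4 + e₀) + J n (suc H) (2 + e₀))
  first = child 0 0 2 z≤n (asc-insAt-first l′ (All.head bnd)) refl
            (trans (run-insAt-first l′ (All.head bnd)) (cong suc run≡)) ≤-refl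
  last : 2 * f (suc H) ≡ A * (J n (suc H) (4 + e₀) + J n H (2 + e₀))
  last = child (suc H) 0 2 ≤-refl
           (trans (cong (λ i → asc (insAt i m l)) (sym run≡)) (asc-insAt-run a l′ bnd (subst (_< m) (sym run≡) run<))) refl
           (run-insAt (suc H) l bnd z<s (≤-reflexive (sym run≡))) (n≤1+n H)
  inner-term : ∀ i → i < H → 2 * f (suc i) ≡ A * (G (2 + e₀) i + G e₀ i)
  inner-term i i<H = begin
    2 * f (suc i)
      ≡⟨ child (suc i) 1 1 (<⇒≤ (s≤s i<H)) (asc-insAt-inside (suc i) l bnd z<s (subst (suc i <_) (sym run≡) (s≤s i<H))) refl
           (run-insAt (suc i) l bnd z<s (subst (suc i ≤_) (sym run≡) (<⇒≤ (s≤s i<H)))) (<⇒≤ (<-trans i<H (n<1+n H))) ⟩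
    2 * A * (J n (suc i) (3 + e₀) + J n i (1 + e₀))
      ≡⟨ solve 3 (λ A x y → con 2 :* A :* (x :+ y) := A :* (con 2 :* x :+ con 2 :* y)) refl
           A (J n (suc i) (3 + e₀)) (J n i (1 + e₀)) ⟩
    A * (2 * J n (suc i) (3 + e₀) + 2 * J n i (1 + e₀))
      -- The extra ascent may carry either sign, so on average it shifts the doubled block number by
      -- an odd amount; `J-affine` splits this midpoint into its two even neighbours.
      ≡⟨ cong (A *_) (cong₂ _+_ (sym (J-affine n (suc i) (2 + e₀))) (sym (J-affine n i e₀))) ⟩
    A * ((J n (suc i) (4 + e₀) + J n (suc i) (2 + e₀)) + (J n i (2 + e₀) + J n i e₀))
      ≡⟨ cong (A *_) (+-interchange (J n (suc i) (4 + e₀)) _ _ _) ⟩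
    A * (G (2 + e₀) i + G e₀ i) ∎
  inner : 2 * Σ< H (f ∘ suc) ≡ A * (Σ< H (G (2 + e₀)) + Σ< H (G e₀))
  inner = trans (sym (Σ<-* 2 H)) (trans (Σ<-cong H inner-term) (trans (Σ<-* A H) (cong (A *_) (Σ<-+ H))))

-- Without ascents there is no sign to choose: the permutation stands for one chain of singleton
-- blocks, whose label is its length. Any insertion other than in front creates a first ascent and
-- passes to `permSum-mixed`.
permSum-decreasing : ∀ n {a l} → IsPerm (length (a ∷ l)) (a ∷ l) → c123 (a ∷ l) ≡ false →
                     run (a ∷ l) ≡ length (a ∷ l) →
                     permSum n (a ∷ l) ≡ J n (length (a ∷ l)) (length (a ∷ l) + length (a ∷ l))
permSum-decreasing zero {a} {l} p c run≡ rewrite c = begin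
  2 ^ asc (a ∷ l) * suc (len+des (a ∷ l)) + 0 ≡⟨ +-identityʳ _ ⟩
  2 ^ asc (a ∷ l) * suc (len+des (a ∷ l))     ≡⟨ cong (λ k → 2 ^ k * suc (len+des (a ∷ l))) asc≡0 ⟩
  1 * suc (len+des (a ∷ l))                   ≡⟨ *-identityˡ _ ⟩
  suc (len+des (a ∷ l))                       ≡⟨ cong (λ k → suc (k + len+des (a ∷ l))) (sym asc≡0) ⟩
  suc (asc (a ∷ l) + len+des (a ∷ l))         ≡⟨ asc+len+des (a ∷ l) z<s ⟩
  length (a ∷ l) + length (a ∷ l) ∎
  where
  open ≡-Reasoning
  asc≡0 = run-full a l run≡
permSum-decreasing (suc n) {a} {l′} p c run≡ = cong₂ _+_ first (Σ<-cong m later)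
  where
  open +-*-Solver
  l = a ∷ l′
  m = length l
  bnd : All (_< m) l
  bnd = entries p
  child-avoids : ∀ i → i ≤ m → c123 (insAt i m l) ≡ false
  child-avoids i i≤ = avoids-child i p c (subst (i ≤_) (sym run≡) i≤) i≤
  first : permSum n (m ∷ l) ≡ J n (suc m) (2 + (m + m))
  first = trans (permSum-decreasing n (isPerm-child 0 p) (child-avoids 0 z≤n)
                  (trans (run-insAt-first l′ (All.head bnd)) (cong suc run≡)))
                (cong (J n (suc m)) (cong suc (+-suc m m)))
  one-ascent : ∀ i → i < m → asc (insAt (suc i) m l) ≡ 1 + asc l
  one-ascent i i<m with suc i <? m
  ... | yes si<m = asc-insAt-inside (suc i) l bnd z<s (subst (suc i <_) (sym run≡) si<m)
  ... | no  si≮m = trans (cong (λ j → asc (insAt j m l)) (≤-antisym i<m (≮⇒≥ si≮m))) (asc-insAt-last a l′ bnd)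
  len+des-eq : suc (len+des l) ≡ m + m
  len+des-eq = trans (cong (λ k → suc (k + len+des l)) (sym (run-full a l′ run≡))) (asc+len+des l z<s)
  later : ∀ i → i < m → permSum n (insAt (suc i) m l) ≡ J n (suc i) (2 + (m + m)) + J n i (m + m)
  -- The child has exactly one ascent, so its weight 2 ^ 1 cancels the factor 2 of the averaged
  -- formula.
  later i i<m = *-cancelˡ-≡ _ _ 2 (trans
    (permSum-mixed n (isPerm-child (suc i) p) (child-avoids (suc i) i<m)
      (run-insAt (suc i) l bnd z<s (subst (suc i ≤_) (sym run≡) i<m))
      (subst (suc i <_) (sym (length-insAt (suc i) m l)) (s<s i<m)))
    (cong₂ (λ k e → 2 ^ k * (J n (suc i) (2 + e) + J n i e))
      (trans (one-ascent i i<m) (cong suc (run-full a l′ run≡)))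
      (trans (len+des-insAt (suc i) l 1 1 z<s (one-ascent i i<m) refl) len+des-eq)))

Σ-Perms-permSum : ∀ m n → Σ[ Perms (suc m) ] (permSum n) ≡ J (suc (m + n)) 0 0
Σ-Perms-permSum zero    n = trans (+-identityʳ _)
  -- The one-entry permutation gives `J n 1 2`, the contribution of the only child of the empty
  -- chain.
  (trans (permSum-decreasing n (perm refl (z<s ∷ []) ([] ∷ [])) refl refl) (sym (+-identityʳ _)))
Σ-Perms-permSum (suc m) n = trans (Σ-Perms-suc (suc m))
  (trans (Σ-cong (Perms (suc m)) (λ l l∈ → byLength (size (∈-Perms⁻ (suc m) l∈))))
  (trans (Σ-Perms-permSum m (suc n)) (cong (λ k → J (suc k) 0 0) (+-suc m n))))
  where
  byLength : ∀ {k l} → length l ≡ k → Σ< (suc k) (λ i → permSum n (insAt i k l)) ≡ permSum (suc n) l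
  byLength refl = refl

-- Permutations containing 123 have at least two ascents

∨-true⁻ : ∀ a {b} → a ∨ b ≡ true → a ≡ true ⊎ b ≡ true
∨-true⁻ true  _  = inj₁ refl
∨-true⁻ false eq = inj₂ eq

asc-tail : ∀ a l → asc l ≤ asc (a ∷ l)
asc-tail a []      = z≤n
asc-tail a (b ∷ l) = m≤n+m _ (if b <ᵇ a then 0 else 1)

any-mono : {p q : α → Bool} → (∀ x → p x ≡ true → q x ≡ true) → ∀ l → any p l ≡ true → any q l ≡ true
any-mono {p = p} {q} imp (x ∷ l) eq with ∨-true⁻ (p x) eq
... | inj₁ px = ∨-true (imp x px)
... | inj₂ pl = trans (cong (q x ∨_) (any-mono imp l pl)) (∨-zeroʳ (q x))

anyPair-mono : {p q : ℕ → ℕ → Bool} → (∀ a b → p a b ≡ true → q a b ≡ true) →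
               ∀ l → anyPair p l ≡ true → anyPair q l ≡ true
anyPair-mono {p} {q} imp (a ∷ l) eq with ∨-true⁻ (any (p a) l) eq
... | inj₁ pa = ∨-true (any-mono (imp a) l pa)
... | inj₂ pl = trans (cong (any (q a) l ∨_) (anyPair-mono imp l pl)) (∨-zeroʳ (any (q a) l))

<ᵇ-true⇒< : ∀ m n → (m <ᵇ n) ≡ true → m < n
<ᵇ-true⇒< m n eq = <ᵇ⇒< m n (≡true⇒T eq)

any-above⇒asc : ∀ a l → any (a <ᵇ_) l ≡ true → 1 ≤ asc (a ∷ l)
any-above⇒asc a (b ∷ l) eq with b <ᵇ a in b<a
... | false = s≤s z≤n
... | true rewrite ≥⇒<ᵇ≡false (<⇒≤ (<ᵇ-true⇒< b a b<a)) = any-above⇒asc b l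
      (any-mono (λ x a<x → <⇒<ᵇ≡true (<-trans (<ᵇ-true⇒< b a b<a) (<ᵇ-true⇒< a x a<x))) l eq)

anyPair⇒asc : ∀ l → anyPair _<ᵇ_ l ≡ true → 1 ≤ asc l
anyPair⇒asc (a ∷ l) eq with ∨-true⁻ (any (a <ᵇ_) l) eq
... | inj₁ e = any-above⇒asc a l e
... | inj₂ e = ≤-trans (anyPair⇒asc l e) (asc-tail a l)

∧-true⁻ : ∀ a {b} → a ∧ b ≡ true → a ≡ true × b ≡ true
∧-true⁻ true eq = refl , eq

-- A smaller next entry can replace `a` as the lowest of the three. Otherwise the first step is one
-- ascent, and the remaining increasing pair forces another.
anyPair-above⇒asc : ∀ a l → anyPair (λ b c → (a <ᵇ b) ∧ (b <ᵇ c)) l ≡ true → 2 ≤ asc (a ∷ l)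
anyPair-above⇒asc a (b ∷ l) eq with b <ᵇ a in b<a
... | false = s≤s (anyPair⇒asc (b ∷ l) (anyPair-mono (λ x y e → proj₂ (∧-true⁻ (a <ᵇ x) e)) (b ∷ l) eq))
... | true rewrite ≥⇒<ᵇ≡false (<⇒≤ (<ᵇ-true⇒< b a b<a)) | any-false l = anyPair-above⇒asc b l (anyPair-mono shift l eq)
  where
  shift : ∀ x y → (a <ᵇ x) ∧ (x <ᵇ y) ≡ true → (b <ᵇ x) ∧ (x <ᵇ y) ≡ true
  shift x y e with a<x , x<y ← ∧-true⁻ (a <ᵇ x) e
    rewrite <⇒<ᵇ≡true (<-trans (<ᵇ-true⇒< b a b<a) (<ᵇ-true⇒< a x a<x)) = x<y

c123⇒asc : ∀ l → c123 l ≡ true → 2 ≤ asc l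
c123⇒asc (a ∷ l) eq with ∨-true⁻ (anyPair _ l) eq
... | inj₁ e = anyPair-above⇒asc a l e
... | inj₂ e = ≤-trans (c123⇒asc l e) (asc-tail a l)

asc+des-perm : ∀ {m l} → IsPerm (suc m) l → asc l + des l ≡ m
asc+des-perm {l = a ∷ l} p = suc-injective (trans (asc+des a l) (size p))

increasing⇒c123 : ∀ {j l} → IsPerm (3 + j) l → des l ≡ 0 → c123 l ≡ true
increasing⇒c123 {l = []} (perm () _ _)
increasing⇒c123 {l = _ ∷ []} (perm () _ _)
increasing⇒c123 {l = _ ∷ _ ∷ []} (perm () _ _)
increasing⇒c123 {l = a ∷ b ∷ c ∷ l} (perm _ _ ((a≢b ∷ _) ∷ (b≢c ∷ _) ∷ _)) d with b <ᵇ a in b<a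
... | false with c <ᵇ b in c<b
...   | false rewrite <⇒<ᵇ≡true (≤∧≢⇒< (≮⇒≥ λ lt → subst T b<a (<⇒<ᵇ lt)) a≢b)
                    | <⇒<ᵇ≡true (≤∧≢⇒< (≮⇒≥ λ lt → subst T c<b (<⇒<ᵇ lt)) b≢c) = refl

-- The weighted sums over descents

avoidWeight : ℕ → ℕ
avoidWeight n = Σ[ Perms n ] (λ σ → [ not (c123 σ) ]ᵇ * 2 ^ asc σ)

newlyContains : ℕ → List ℕ → Bool
newlyContains n σ = c123 σ ∧ not (c123 (deleteMax n σ))

containWeight : ℕ → ℕ
containWeight n = Σ[ Perms n ] (λ σ → [ newlyContains n σ ]ᵇ * 2 ^ asc σ)

≡ᵇ-refl : ∀ n → (n ≡ᵇ n) ≡ true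
≡ᵇ-refl n = T⇒≡true (≡⇒≡ᵇ n n refl)

≢⇒≡ᵇ≡false : ∀ {m n} → m ≢ n → (m ≡ᵇ n) ≡ false
≢⇒≡ᵇ≡false {m} {n} ne = ¬T⇒≡false (ne ∘ ≡ᵇ⇒≡ m n)

-- After exchanging the sums, each permutation is met only at `d = des σ`, where `m ∸ d` is its
-- number of ascents; the bound places this `d` in the range of summation.
byDescents : ∀ m D (p : List ℕ → Bool) → (∀ {σ} → IsPerm (suc m) σ → p σ ≡ true → des σ < D) →
             Σ[ upTo D ] (λ d → 2 ^ (m ∸ d) * Σ[ Perms (suc m) ] (λ σ → [ p σ ]ᵇ * [ des σ ≡ᵇ d ]ᵇ))
             ≡ Σ[ Perms (suc m) ] (λ σ → [ p σ ]ᵇ * 2 ^ asc σ)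
byDescents m D p bound = begin
  Σ[ upTo D ] (λ d → 2 ^ (m ∸ d) * Σ[ P ] (λ σ → [ p σ ]ᵇ * [ des σ ≡ᵇ d ]ᵇ))
    ≡⟨ Σ-cong (upTo D) (λ d _ → sym (Σ-* (2 ^ (m ∸ d)) P)) ⟩
  Σ[ upTo D ] (λ d → Σ[ P ] (λ σ → term σ d))
    ≡⟨ Σ-swap (upTo D) P {λ d σ → term σ d} ⟩
  Σ[ P ] (λ σ → Σ[ upTo D ] (term σ))
    ≡⟨ Σ-cong P (λ σ σ∈ → trans (Σ-upTo D {term σ}) (single σ (∈-Perms⁻ (suc m) σ∈))) ⟩
  Σ[ P ] (λ σ → [ p σ ]ᵇ * 2 ^ asc σ) ∎
  where
  open ≡-Reasoning
  P = Perms (suc m)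
  term : List ℕ → ℕ → ℕ
  term σ d = 2 ^ (m ∸ d) * ([ p σ ]ᵇ * [ des σ ≡ᵇ d ]ᵇ)
  single : ∀ σ → IsPerm (suc m) σ → Σ< D (term σ) ≡ [ p σ ]ᵇ * 2 ^ asc σ
  single σ isP with p σ in eq
  ... | false = trans (Σ<-cong D (λ d _ → *-zeroʳ (2 ^ (m ∸ d)))) (Σ<-0 D)
  ... | true  = trans (Σ<-single D _ (des σ) (bound isP eq)
      (λ d d≢ → trans (cong (λ t → 2 ^ (m ∸ d) * (1 * [ t ]ᵇ)) (≢⇒≡ᵇ≡false (d≢ ∘ sym))) (*-zeroʳ (2 ^ (m ∸ d)))))
    (begin
      2 ^ (m ∸ des σ) * (1 * [ des σ ≡ᵇ des σ ]ᵇ)  ≡⟨ cong (λ t → 2 ^ (m ∸ des σ) * (1 * [ t ]ᵇ)) (≡ᵇ-refl (des σ)) ⟩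
      2 ^ (m ∸ des σ) * 1                          ≡⟨ *-comm _ 1 ⟩
      1 * 2 ^ (m ∸ des σ)                          ≡⟨ cong (λ k → 1 * 2 ^ (k ∸ des σ)) (sym (asc+des-perm isP)) ⟩
      1 * 2 ^ (asc σ + des σ ∸ des σ)              ≡⟨ cong (λ k → 1 * 2 ^ k) (m+n∸n≡m (asc σ) (des σ)) ⟩
      1 * 2 ^ asc σ ∎)

e-Σ : ∀ n d → e n d ≡ Σ[ Perms n ] (λ σ → [ not (c123 σ) ]ᵇ * [ des σ ≡ᵇ d ]ᵇ)
e-Σ n d = trans (count≡Σ _ (Perms n)) (Σ-cong (Perms n) (λ σ _ → trans
  (cong₂ (λ s k → [ not s ∧ (k ≡ᵇ d) ]ᵇ) (contains123≡c123 σ) (descents≡des σ))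
  ([∧]≡* (not (c123 σ)) (des σ ≡ᵇ d))))

gCount-Σ : ∀ j d → gCount j d ≡ Σ[ Perms j ] (λ σ → [ newlyContains j σ ]ᵇ * [ des σ ≡ᵇ d ]ᵇ)
gCount-Σ j d = trans (count≡Σ _ (Perms j)) (Σ-cong (Perms j) (λ σ _ → trans
  (cong₂ (λ s t → [ s ∧ ((descents σ ≡ᵇ d) ∧ not t) ]ᵇ) (contains123≡c123 σ) (contains123≡c123 (deleteMax j σ)))
  (trans (cong (λ k → [ c123 σ ∧ ((k ≡ᵇ d) ∧ not (c123 (deleteMax j σ))) ]ᵇ) (descents≡des σ))
         (rearrange (c123 σ) (des σ ≡ᵇ d) _))))
  where
  rearrange : ∀ a b c → [ a ∧ (b ∧ c) ]ᵇ ≡ [ a ∧ c ]ᵇ * [ b ]ᵇ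
  rearrange false b     c = refl
  rearrange true  true  c = sym (*-identityʳ [ c ]ᵇ)
  rearrange true  false c = sym (*-zeroʳ [ c ]ᵇ)

-- Deleting the maximum creates no descent, so it would leave an increasing list of at least three
-- entries, which contains 123. This justifies the range d ≥ 1 for j > 3.
gCount-no-descents : ∀ j → gCount (4 + j) 0 ≡ 0
gCount-no-descents j = trans (gCount-Σ (4 + j) 0) (trans (Σ-Perms-suc (3 + j))
  (trans (Σ-cong (Perms (3 + j)) (λ l l∈ → trans
      (Σ<-cong (4 + j) (λ i _ → vanish l i (∈-Perms⁻ (3 + j) l∈))) (Σ<-0 (4 + j))))
    (Σ-0 (Perms (3 + j)))))
  where
  vanish : ∀ l i → IsPerm (3 + j) l →
           [ newlyContains (4 + j) (insAt i (3 + j) l) ]ᵇ * [ des (insAt i (3 + j) l) ≡ᵇ 0 ]ᵇ ≡ 0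
  vanish l i isP with des (insAt i (3 + j) l) in eq
  ... | suc _ = *-zeroʳ [ newlyContains (4 + j) (insAt i (3 + j) l) ]ᵇ
  ... | zero  = trans (*-identityʳ _) (cong [_]ᵇ (trans
      (cong (λ t → c123 (insAt i (3 + j) l) ∧ not t) (trans (cong c123 (deleteMax-insAt i (3 + j) l (entries isP)))
        (increasing⇒c123 isP (n≤0⇒n≡0 (subst (des l ≤_) eq (des-insAt-≤ i l (entries isP)))))))
      (∧-zeroʳ _)))

g≡gCount : ∀ j {d} → d < suc j → g (3 + j) d ≡ gCount (3 + j) d
-- `gCount 3 0` evaluates to 1, the increasing permutation being the only one counted.
g≡gCount zero    {zero}  _           = refl
g≡gCount zero    {suc d} (s<s ())
g≡gCount (suc j) {zero}  _           = sym (gCount-no-descents j)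
g≡gCount (suc j) {suc d} (s<s d<)    =
  cong (λ t → if t then gCount (4 + j) (suc d) else 0) (trans (≤ᵇ'≡<ᵇ (suc d + 3) (4 + j))
    (<⇒<ᵇ≡true (s≤s (subst (_≤ 4 + j) (+-comm 3 (suc d)) (+-monoʳ-≤ 3 d<)))))

rhs-weights : ∀ m → rhs (suc m) ≡ avoidWeight (suc m) + Σ< (m ∸ 1) (λ j → containWeight (3 + j))
rhs-weights m = cong₂ _+_
  (trans (Σ-cong (upTo (suc m)) (λ d _ → cong (2 ^ (m ∸ d) *_) (e-Σ (suc m) d)))
    (byDescents m (suc m) (not ∘ c123) (λ {σ} isP _ → s≤s (subst (des σ ≤_) (asc+des-perm isP) (m≤n+m _ (asc σ))))))
  (trans (Σ-map (3 +_) (upTo (m ∸ 1)) {λ j → Σ[ upTo (j ∸ 2) ] (λ d → 2 ^ (j ∸ 1 ∸ d) * g j d)})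
  (trans (Σ-upTo (m ∸ 1)) (Σ<-cong (m ∸ 1) (λ j _ → inner j))))
  where
  few-descents : ∀ {j σ} → IsPerm (3 + j) σ → newlyContains (3 + j) σ ≡ true → des σ < suc j
  few-descents {j} {σ} isP eq = s≤s (+-cancelˡ-≤ 2 _ _ (subst (2 + des σ ≤_) (asc+des-perm isP)
    (+-monoˡ-≤ (des σ) (c123⇒asc σ (proj₁ (∧-true⁻ (c123 σ) eq))))))
  inner : ∀ j → Σ[ upTo (suc j) ] (λ d → 2 ^ (2 + j ∸ d) * g (3 + j) d) ≡ containWeight (3 + j)
  inner j = trans (Σ-cong (upTo (suc j)) (λ d d∈ →
      cong (2 ^ (2 + j ∸ d) *_) (trans (g≡gCount j (∈-upTo⁻ d∈)) (gCount-Σ (3 + j) d))))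
    (byDescents (2 + j) (suc j) (newlyContains (3 + j)) few-descents)

-- The recurrence on the permutation side

weights-suc : ∀ m → avoidWeight (2 + m) + containWeight (2 + m) ≡ avoidWeight (suc m) + J (suc m) 0 0
weights-suc m = begin
  avoidWeight (2 + m) + containWeight (2 + m)
    ≡⟨ sym (Σ-+ (Perms (2 + m))) ⟩
  Σ[ Perms (2 + m) ] live
    ≡⟨ Σ-Perms-suc (suc m) ⟩
  Σ[ Perms (suc m) ] (λ l → Σ< (2 + m) (λ i → live (insAt i (suc m) l)))
    ≡⟨ Σ-cong (Perms (suc m)) (λ l l∈ → perParent l (∈-Perms⁻ (suc m) l∈)) ⟩
  Σ[ Perms (suc m) ] (λ l → [ not (c123 l) ]ᵇ * 2 ^ asc l + permSum 0 l)
    ≡⟨ Σ-+ (Perms (suc m)) ⟩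
  avoidWeight (suc m) + Σ[ Perms (suc m) ] (permSum 0)
    ≡⟨ cong (avoidWeight (suc m) +_) (trans (Σ-Perms-permSum m 0) (cong (λ k → J (suc k) 0 0) (+-identityʳ m))) ⟩
  avoidWeight (suc m) + J (suc m) 0 0 ∎
  where
  open ≡-Reasoning
  live : List ℕ → ℕ
  live σ = [ not (c123 σ) ]ᵇ * 2 ^ asc σ + [ newlyContains (2 + m) σ ]ᵇ * 2 ^ asc σ
  live-insAt : ∀ {l} i → IsPerm (suc m) l → i < 2 + m →
               live (insAt i (suc m) l) ≡ [ not (c123 l) ]ᵇ * 2 ^ asc (insAt i (suc m) l)
  live-insAt {l} i isP i≤
    rewrite deleteMax-insAt i (suc m) l (entries isP)
          | c123-insAt i l (entries isP) (distinctEntries isP) (subst (i ≤_) (sym (size isP)) (s≤s⁻¹ i≤))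
    = trans (sym (*-distribʳ-+ (2 ^ asc (insAt i (suc m) l)) [ not (c123 l ∨ (run l <ᵇ i)) ]ᵇ _))
            (cong (_* 2 ^ asc (insAt i (suc m) l)) (live-split (c123 l) (run l <ᵇ i)))
  perParent : ∀ l → IsPerm (suc m) l →
              Σ< (2 + m) (λ i → live (insAt i (suc m) l)) ≡ [ not (c123 l) ]ᵇ * 2 ^ asc l + permSum 0 l
  perParent l@(a ∷ l′) isP@(perm refl bnd u) = begin
    Σ< (2 + m) (λ i → live (insAt i (suc m) l))     ≡⟨ Σ<-cong (2 + m) (λ i → live-insAt i isP) ⟩
    Σ< (2 + m) (λ i → v * 2 ^ asc (insAt i (suc m) l)) ≡⟨ Σ<-* v (2 + m) {λ i → 2 ^ asc (insAt i (suc m) l)} ⟩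
    v * Σ< (2 + m) (λ i → 2 ^ asc (insAt i (suc m) l)) ≡⟨ cong (v *_) (Σ-2^asc a l′ bnd) ⟩
    v * (2 ^ asc l * (2 + len+des l))               ≡⟨ cong (v *_) (*-suc (2 ^ asc l) _) ⟩
    v * (2 ^ asc l + 2 ^ asc l * suc (len+des l))   ≡⟨ *-distribˡ-+ v _ _ ⟩
    v * 2 ^ asc l + permSum 0 l ∎
    where v = [ not (c123 l) ]ᵇ

rhs-suc : ∀ m → rhs (3 + m) ≡ rhs (2 + m) + J (2 + m) 0 0
rhs-suc m = begin
  rhs (3 + m)
    ≡⟨ rhs-weights (2 + m) ⟩
  avoidWeight (3 + m) + Σ< (suc m) cw
    ≡⟨ cong (avoidWeight (3 + m) +_) (Σ<-last m cw) ⟩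
  avoidWeight (3 + m) + (Σ< m cw + cw m)
    ≡⟨ solve 3 (λ a s c → a :+ (s :+ c) := (a :+ c) :+ s) refl (avoidWeight (3 + m)) (Σ< m cw) (cw m) ⟩
  (avoidWeight (3 + m) + cw m) + Σ< m cw
    ≡⟨ cong (_+ Σ< m cw) (weights-suc (suc m)) ⟩
  (avoidWeight (2 + m) + J (2 + m) 0 0) + Σ< m cw
    ≡⟨ solve 3 (λ a s c → (a :+ c) :+ s := (a :+ s) :+ c) refl (avoidWeight (2 + m)) (Σ< m cw) (J (2 + m) 0 0) ⟩
  (avoidWeight (2 + m) + Σ< m cw) + J (2 + m) 0 0
    ≡⟨ cong (_+ J (2 + m) 0 0) (sym (rhs-weights (suc m))) ⟩
  rhs (2 + m) + J (2 + m) 0 0 ∎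
  where
  open ≡-Reasoning
  open +-*-Solver
  cw : ℕ → ℕ
  cw j = containWeight (3 + j)

w≡rhs : ∀ n → n ≥ 1 → w n ≡ rhs n
w≡rhs (suc zero)    _ = refl
w≡rhs (suc (suc m)) _ = from-two m
  where
  from-two : ∀ m → w (2 + m) ≡ rhs (2 + m)
  -- Sizes 1 and 2 are evaluated, since the second sum on the right only starts at size 3; from 2 on
  -- both sides grow by the same `J`.
  from-two zero    = refl
  from-two (suc m) = trans (w-suc (2 + m)) (trans (cong (_+ J (2 + m) 0 0) (from-two m)) (sym (rhs-suc m)))

-- A form that evaluates quickly, for the listed values; `w 9` by definition would run through 9^9
-- words.
ΣJ : ℕ → ℕ
ΣJ zero    = 1
ΣJ (suc n) = ΣJ n + J n 0 0

w≡ΣJ : ∀ n → w n ≡ ΣJ n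
w≡ΣJ zero    = refl
w≡ΣJ (suc n) = trans (w-suc n) (cong (_+ J n 0 0) (w≡ΣJ n))

import Data.Nat as ℕ
open import Data.Integer as ℤ using (ℤ; +_; -[1+_]; 0ℤ; 1ℤ)
import Data.Integer.Properties as ℤₚ
open CommutativeSemigroup ℤₚ.+-commutativeSemigroup using () renaming (interchange to ℤ-interchange)

-- Formal power series over ℤ

infix 4 _≈_
_≈_ : Series → Series → Set
f ≈ h = ∀ n → f n ≡ h n

infixl 25 _·_
-- The Cauchy product, recursive in the constant term of the first factor, so that the ring laws
-- follow by induction on the index.
_·_ : Series → Series → Series
(f · h) zero    = f 0 ℤ.* h 0
(f · h) (suc n) = f 0 ℤ.* h (suc n) ℤ.+ ((f ∘ suc) · h) n

const : ℤ → Series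
const a zero    = a
const a (suc n) = 0ℤ

neg : Series → Series
neg f n = ℤ.- f n

one : Series
one = const 1ℤ

zero-const : ∀ n → const 0ℤ n ≡ 0ℤ
zero-const zero    = refl
zero-const (suc n) = refl

·-cong : ∀ {f f′ h h′} → f ≈ f′ → h ≈ h′ → f · h ≈ f′ · h′
·-cong p q zero    = cong₂ ℤ._*_ (p 0) (q 0)
·-cong p q (suc n) = cong₂ ℤ._+_ (cong₂ ℤ._*_ (p 0) (q (suc n))) (·-cong (p ∘ suc) q n)

·-distribˡ : ∀ f h k → f · (h ⊕ k) ≈ (f · h) ⊕ (f · k)
·-distribˡ f h k zero    = ℤₚ.*-distribˡ-+ (f 0) (h 0) (k 0)
·-distribˡ f h k (suc n) = trans
  (cong₂ ℤ._+_ (ℤₚ.*-distribˡ-+ (f 0) (h (suc n)) (k (suc n))) (·-distribˡ (f ∘ suc) h k n))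
  (ℤ-interchange (f 0 ℤ.* h (suc n)) _ _ _)

·-distribʳ : ∀ f h k → (h ⊕ k) · f ≈ (h · f) ⊕ (k · f)
·-distribʳ f h k zero    = ℤₚ.*-distribʳ-+ (f 0) (h 0) (k 0)
·-distribʳ f h k (suc n) = trans
  (cong₂ ℤ._+_ (ℤₚ.*-distribʳ-+ (f (suc n)) (h 0) (k 0)) (·-distribʳ f (h ∘ suc) (k ∘ suc) n))
  (ℤ-interchange (h 0 ℤ.* f (suc n)) _ _ _)

const-· : ∀ a h n → (const a · h) n ≡ a ℤ.* h n
const-· a h zero    = refl
const-· a h (suc n) = trans (cong (ℤ._+_ (a ℤ.* h (suc n))) (zero-· n)) (ℤₚ.+-identityʳ _)
  where
  zero-· : ∀ n → ((λ _ → 0ℤ) · h) n ≡ 0ℤ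
  zero-· zero    = refl
  zero-· (suc n) = trans (ℤₚ.+-identityˡ _) (zero-· n)

-- Splits off the constant term of the second factor instead, the mirror image that commutativity
-- needs.
·-tailʳ : ∀ f h n → (f · h) (suc n) ≡ f (suc n) ℤ.* h 0 ℤ.+ (f · (h ∘ suc)) n
·-tailʳ f h zero    = ℤₚ.+-comm (f 0 ℤ.* h 1) _
·-tailʳ f h (suc n) = begin
  a ℤ.+ ((f ∘ suc) · h) (suc n)  ≡⟨ cong (ℤ._+_ a) (·-tailʳ (f ∘ suc) h n) ⟩
  a ℤ.+ (b ℤ.+ c)                ≡⟨ sym (ℤₚ.+-assoc a b c) ⟩
  (a ℤ.+ b) ℤ.+ c                ≡⟨ cong (ℤ._+ c) (ℤₚ.+-comm a b) ⟩
  (b ℤ.+ a) ℤ.+ c                ≡⟨ ℤₚ.+-assoc b a c ⟩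
  b ℤ.+ (a ℤ.+ c) ∎
  where
  open ≡-Reasoning
  a = f 0 ℤ.* h (suc (suc n))
  b = f (suc (suc n)) ℤ.* h 0
  c = ((f ∘ suc) · (h ∘ suc)) n

·-comm : ∀ f h → f · h ≈ h · f
·-comm f h zero    = ℤₚ.*-comm (f 0) (h 0)
·-comm f h (suc n) = trans (cong₂ ℤ._+_ (ℤₚ.*-comm (f 0) (h (suc n))) (·-comm (f ∘ suc) h n))
                           (sym (·-tailʳ h f n))

scale-· : ∀ a f h n → ((λ m → a ℤ.* f m) · h) n ≡ a ℤ.* (f · h) n
scale-· a f h zero    = ℤₚ.*-assoc a (f 0) (h 0)
scale-· a f h (suc n) = trans
  (cong₂ ℤ._+_ (ℤₚ.*-assoc a (f 0) (h (suc n))) (scale-· a (f ∘ suc) h n))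
  (sym (ℤₚ.*-distribˡ-+ a (f 0 ℤ.* h (suc n)) _))

·-assoc : ∀ f h k → (f · h) · k ≈ f · (h · k)
·-assoc f h k zero    = ℤₚ.*-assoc (f 0) (h 0) (k 0)
·-assoc f h k (suc n) = begin
  (f 0 ℤ.* h 0) ℤ.* k (suc n) ℤ.+ (((λ m → f 0 ℤ.* h (suc m)) ⊕ ((f ∘ suc) · h)) · k) n
    ≡⟨ cong₂ ℤ._+_ (ℤₚ.*-assoc (f 0) (h 0) _) (·-distribʳ k (λ m → f 0 ℤ.* h (suc m)) ((f ∘ suc) · h) n) ⟩
  f 0 ℤ.* (h 0 ℤ.* k (suc n)) ℤ.+ (((λ m → f 0 ℤ.* h (suc m)) · k) n ℤ.+ (((f ∘ suc) · h) · k) n)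
    ≡⟨ cong (ℤ._+_ (f 0 ℤ.* (h 0 ℤ.* k (suc n)))) (cong₂ ℤ._+_ (scale-· (f 0) (h ∘ suc) k n) (·-assoc (f ∘ suc) h k n)) ⟩
  f 0 ℤ.* (h 0 ℤ.* k (suc n)) ℤ.+ (f 0 ℤ.* ((h ∘ suc) · k) n ℤ.+ ((f ∘ suc) · (h · k)) n)
    ≡⟨ sym (ℤₚ.+-assoc (f 0 ℤ.* (h 0 ℤ.* k (suc n))) _ _) ⟩
  (f 0 ℤ.* (h 0 ℤ.* k (suc n)) ℤ.+ f 0 ℤ.* ((h ∘ suc) · k) n) ℤ.+ ((f ∘ suc) · (h · k)) n
    ≡⟨ cong (ℤ._+ ((f ∘ suc) · (h · k)) n) (sym (ℤₚ.*-distribˡ-+ (f 0) (h 0 ℤ.* k (suc n)) _)) ⟩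
  f 0 ℤ.* (h · k) (suc n) ℤ.+ ((f ∘ suc) · (h · k)) n ∎
  where open ≡-Reasoning

·-identityˡ : ∀ f → one · f ≈ f
·-identityˡ f n = trans (const-· 1ℤ f n) (ℤₚ.*-identityˡ (f n))

seriesRing : CommutativeRing 0ℓ 0ℓ
seriesRing = record
  { Carrier = Series ; _≈_ = _≈_ ; _+_ = _⊕_ ; _*_ = _·_ ; -_ = neg ; 0# = const 0ℤ ; 1# = one
  ; isCommutativeRing = record
    { isRing = record
      { +-isAbelianGroup = record
        { isGroup = record
          { isMonoid = record
            { isSemigroup = record
              { isMagma = record
                { isEquivalence = record
                  { refl = λ _ → refl ; sym = λ p n → sym (p n) ; trans = λ p q n → trans (p n) (q n) }
                ; ∙-cong = λ p q n → cong₂ ℤ._+_ (p n) (q n) }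
              ; assoc = λ f h k n → ℤₚ.+-assoc (f n) (h n) (k n) }
            ; identity = (λ f n → trans (cong (ℤ._+ f n) (zero-const n)) (ℤₚ.+-identityˡ (f n)))
                       , (λ f n → trans (cong (ℤ._+_ (f n)) (zero-const n)) (ℤₚ.+-identityʳ (f n))) }
          ; inverse = (λ f n → trans (ℤₚ.+-inverseˡ (f n)) (sym (zero-const n)))
                    , (λ f n → trans (ℤₚ.+-inverseʳ (f n)) (sym (zero-const n)))
          ; ⁻¹-cong = λ p n → cong ℤ.-_ (p n) }
        ; comm = λ f h n → ℤₚ.+-comm (f n) (h n) }
      ; *-cong = ·-cong
      ; *-assoc = ·-assoc
      ; *-identity = ·-identityˡ , (λ f n → trans (·-comm f one n) (·-identityˡ f n))
      ; distrib = ·-distribˡ , ·-distribʳ }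
    ; *-comm = ·-comm } }

ℤ-rawRing : RawRing 0ℓ 0ℓ
ℤ-rawRing = ℤ.+-*-rawRing

-- The solver must decide equality of coefficients; integers embedded as constant series permit
-- this, series themselves do not.
constMorphism : ℤ-rawRing -Raw-AlmostCommutative⟶ fromCommutativeRing seriesRing
constMorphism = record
  { ⟦_⟧    = const
  ; +-homo = λ { a b zero → refl ; a b (suc n) → refl }
  ; *-homo = λ { a b zero → refl ; a b (suc n) → sym (trans (const-· a (const b) (suc n)) (ℤₚ.*-zeroʳ a)) }
  ; -‿homo = λ { a zero → refl ; a (suc n) → refl }
  ; 0-homo = λ _ → refl
  ; 1-homo = λ _ → refl }

coeff≟ : ∀ a b → Maybe (const a ≈ const b)
coeff≟ a b with a ℤₚ.≟ b
... | yes refl = just (λ _ → refl)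
... | no _     = nothing

module Solver = RingSolver ℤ-rawRing (fromCommutativeRing seriesRing) constMorphism coeff≟

open Solver using (solve; _:=_; _:+_; _:*_; _:-_; con)

infix 20 _-ˢ_
_-ˢ_ : Series → Series → Series
f -ˢ h = f ⊕ neg h

difference-zero : ∀ {f h} → f ≈ h → f -ˢ h ≈ const 0ℤ
difference-zero {f} {h} p n = trans (trans (cong (ℤ._- h n) (p n)) (ℤₚ.+-inverseʳ (h n))) (sym (zero-const n))

multiple-zero : ∀ q {f h} → f ≈ h → q · (f -ˢ h) ≈ const 0ℤ
multiple-zero q {f} {h} p n = trans (·-cong {q} (λ _ → refl) (difference-zero {f} {h} p) n)
  (trans (·-comm q (const 0ℤ) n) (trans (const-· 0ℤ q n) (sym (zero-const n))))

≈-trans : ∀ {f h k} → f ≈ h → h ≈ k → f ≈ k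
≈-trans p q n = trans (p n) (q n)

≈-sym : ∀ {f h} → f ≈ h → h ≈ f
≈-sym p n = sym (p n)

⊕-cong : ∀ {f f′ h h′} → f ≈ f′ → h ≈ h′ → f ⊕ h ≈ f′ ⊕ h′
⊕-cong p q n = cong₂ ℤ._+_ (p n) (q n)

-- The second relation is a ring identity, left to the solver.
by-relation : ∀ q {a b f h} → a ≈ b → h ⊕ q · (a -ˢ b) ≈ f → f ≈ h
by-relation q {a} {b} {f} {h} rel ident n = trans (sym (ident n))
  (trans (cong (ℤ._+_ (h n)) (trans (multiple-zero q {a} {b} rel n) (zero-const n))) (ℤₚ.+-identityʳ (h n)))

X : Series
X zero    = 0ℤ
X (suc n) = one n

shift : Series → Series
shift f zero    = 0ℤ
shift f (suc n) = f n

X-· : ∀ f → X · f ≈ shift f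
X-· f zero    = refl
X-· f (suc n) = trans (ℤₚ.+-identityˡ _) (·-identityˡ f n)

-- Fixed points of contractions of ℤ[[x]]

Agree : ℕ → Series → Series → Set
Agree n f h = ∀ i → i < n → f i ≡ h i

-- Contraction in the x-adic metric: each application fixes one more coefficient.
Contraction : (Series → Series) → Set
Contraction Φ = ∀ {n f h} → Agree n f h → Agree (suc n) (Φ f) (Φ h)

module Fixpoint (Φ : Series → Series) (contract : Contraction Φ) where

  approx : ℕ → Series
  approx zero    = const 0ℤ
  approx (suc n) = Φ (approx n)

  -- Coefficient n no longer changes from the (n + 1)-st iterate on.
  fixpoint : Series
  fixpoint n = approx (suc n) n

  approx-step : ∀ n → Agree n (approx n) (approx (suc n))
  approx-step zero    i ()
  approx-step (suc n) = contract (approx-step n)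

  approx-stable : ∀ {m n} → m ℕ.≤′ n → Agree m (approx m) (approx n)
  approx-stable ℕ.≤′-refl       i i<m = refl
  approx-stable (ℕ.≤′-step m≤n) i i<m =
    trans (approx-stable m≤n i i<m) (approx-step _ i (<-≤-trans i<m (≤′⇒≤ m≤n)))

  fixpoint-agree : ∀ n → Agree n fixpoint (approx n)
  fixpoint-agree n i i<n = approx-stable (≤⇒≤′ i<n) i (n<1+n i)

  fixpoint-eq : fixpoint ≈ Φ fixpoint
  fixpoint-eq n = sym (contract (fixpoint-agree n) n (n<1+n n))

Agree-· : ∀ {n f f′ h h′} → Agree n f f′ → Agree n h h′ → Agree n (f · h) (f′ · h′)
Agree-· p q zero    0<n = cong₂ ℤ._*_ (p 0 0<n) (q 0 0<n)
Agree-· {suc n} p q (suc i) (s<s i<n) = cong₂ ℤ._+_ (cong₂ ℤ._*_ (p 0 z<s) (q (suc i) (s<s i<n)))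
  (Agree-· {n} (λ j j<n → p (suc j) (s<s j<n)) (λ j j<n → q j (<-trans j<n (n<1+n n))) i i<n)

Agree-⊕ : ∀ {n f f′ h h′} → Agree n f f′ → Agree n h h′ → Agree n (f ⊕ h) (f′ ⊕ h′)
Agree-⊕ p q i i<n = cong₂ ℤ._+_ (p i i<n) (q i i<n)

Agree-refl : ∀ {n f} → Agree n f f
Agree-refl _ _ = refl

Agree-shift : ∀ {n f h} → Agree n f h → Agree (suc n) (shift f) (shift h)
Agree-shift p zero    _         = refl
Agree-shift p (suc i) (s<s i<n) = p i i<n

-- C(x) is the Catalan series at x + x².
stepC : Series → Series
stepC f = one ⊕ shift ((one ⊕ X) · (f · f))

contractC : Contraction stepC
contractC {f = f} {h} p = Agree-⊕ {f = one} {one} Agree-refl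
  (Agree-shift (Agree-· {f = one ⊕ X} {one ⊕ X} Agree-refl (Agree-· {f = f} {h} p p)))

module FixC = Fixpoint stepC contractC

C U : Series
C = FixC.fixpoint
U = (one ⊕ X) · C

-- The y-derivative at y = 1 of C = 1 + y (x + x²) C², namely D = xUC + 2xUD.
stepD : Series → Series
stepD f = shift (U · C ⊕ (U · f ⊕ U · f))

contractD : Contraction stepD
contractD {f = f} {h} p = Agree-shift (Agree-⊕ {f = U · C} {U · C} Agree-refl
  (Agree-⊕ {f = U · f} {U · h} (Agree-· {f = U} {U} Agree-refl p) (Agree-· {f = U} {U} Agree-refl p)))

module FixD = Fixpoint stepD contractD

D : Series
D = FixD.fixpoint

C-eq : C ≈ one ⊕ X · (U · C)
C-eq = ≈-trans FixC.fixpoint-eq (⊕-cong {one} (λ _ → refl)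
  (≈-trans (≈-sym (X-· ((one ⊕ X) · (C · C))))
           (·-cong {X} (λ _ → refl) (≈-sym (·-assoc (one ⊕ X) C C)))))

D-eq : D ≈ X · (U · C) ⊕ X · (U · D ⊕ U · D)
D-eq = ≈-trans FixD.fixpoint-eq (≈-trans (≈-sym (X-· (U · C ⊕ (U · D ⊕ U · D)))) (·-distribˡ X (U · C) (U · D ⊕ U · D)))

U-eq : U ≈ (one ⊕ X) ⊕ X · (U · U)
U-eq = by-relation (one ⊕ X) {C} {one ⊕ X · (U · C)} C-eq
  (solve 2 (λ x c → let u = (con 1ℤ :+ x) :* c in
      (con 1ℤ :+ x :+ x :* (u :* u)) :+ (con 1ℤ :+ x) :* (c :- (con 1ℤ :+ x :* (u :* c))) := u)
    (λ _ → refl) X C)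

-- Generating function of the weights J

pow : Series → ℕ → Series
pow f zero    = one
pow f (suc h) = f · pow f h

nat : ℕ → Series
nat k = const (+ k)

nat-suc : ∀ k → nat (suc k) ≈ one ⊕ nat k
nat-suc k zero    = refl
nat-suc k (suc n) = refl

-- The power U^h and the constants h + 1 and c are parameters, so that the solver meets them as
-- variables.
Yform : Series → Series → Series → Series
Yform p k c = c · (C · p) ⊕ (one ⊕ one) · (k · (p · D))

Yform-cong : ∀ p {k k′ c c′} → k ≈ k′ → c ≈ c′ → Yform p k c ≈ Yform p k′ c′
Yform-cong p {k} {k′} {c} {c′} eqk eqc = ⊕-cong {c · (C · p)} (·-cong {c} {c′} {C · p} eqc (λ _ → refl))
  (·-cong {one ⊕ one} (λ _ → refl) (·-cong {k} {k′} {p · D} eqk (λ _ → refl)))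

-- Closed form of the generating function of n ↦ J n h c; with y marking blocks, it is
-- 2 y ∂/∂y of y^(c/2) C^(h+1) (1+x)^h at y = 1, where C is taken at y (x + x²) and D = ∂C/∂y.
Y : ℕ → ℕ → Series
Y h c = Yform (pow U h) (nat (suc h)) (nat c)

ΣS : ℕ → (ℕ → Series) → Series
ΣS zero    f = const 0ℤ
ΣS (suc n) f = f 0 ⊕ ΣS n (f ∘ suc)

ΣS-last : ∀ n f → ΣS (suc n) f ≈ ΣS n f ⊕ f n
ΣS-last zero    f m = ℤₚ.+-comm (f 0 m) _
ΣS-last (suc n) f m = trans (cong (ℤ._+_ (f 0 m)) (ΣS-last n (f ∘ suc) m)) (sym (ℤₚ.+-assoc (f 0 m) _ _))

two : Series → Series
two c = one ⊕ (one ⊕ c)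

nat-two : ∀ c → nat (2 ℕ.+ c) ≈ two (nat c)
nat-two c zero    = refl
nat-two c (suc n) = refl

-- The recursions at labels h + 1 and h differ by Y(h+1) - Y(h) = x (Y(h+2) + Y(h)). For powers of U
-- this reads U - 1 = x (U² + 1), which is `U-eq`; the terms from marking blocks reduce by `D-eq`.
Yform-step : ∀ p k c → Yform (U · p) (one ⊕ k) c ≈ Yform p k c ⊕ X · (Yform (U · (U · p)) (two k) (two c) ⊕ Yform p k c)
Yform-step p k c = by-relation (p · (c · C ⊕ (one ⊕ one) · (k · D))) {U} {(one ⊕ X) ⊕ X · (U · U)} U-eq
  (≈-sym (by-relation ((one ⊕ one) · (p · U)) {D} {X · (U · C) ⊕ X · (U · D ⊕ U · D)} D-eq
    (solve 7 (λ x u c′ d p k c →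
      let one = con 1ℤ
          y p k c = c :* (c′ :* p) :+ (one :+ one) :* (k :* (p :* d)) in
      ((y p k c :+ x :* (y (u :* (u :* p)) (one :+ (one :+ k)) (one :+ (one :+ c)) :+ y p k c))
        :+ (p :* (c :* c′ :+ (one :+ one) :* (k :* d))) :* (u :- ((one :+ x) :+ x :* (u :* u))))
        :+ ((one :+ one) :* (p :* u)) :* (d :- (x :* (u :* c′) :+ x :* (u :* d :+ u :* d)))
      := y (u :* p) (one :+ k) c)
      (λ _ → refl) X U C D p k c)))

Y-step : ∀ h c → Y (suc h) c ≈ Y h c ⊕ X · (Y (suc (suc h)) (2 ℕ.+ c) ⊕ Y h c)
Y-step h c = ≈-trans (Yform-cong (U · pow U h) {c = nat c} (nat-suc (suc h)) (λ _ → refl))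
  (≈-trans (Yform-step (pow U h) (nat (suc h)) (nat c))
  (⊕-cong {Y h c} (λ _ → refl) (·-cong {X} (λ _ → refl) (⊕-cong {h = Y h c} (≈-sym
    (Yform-cong (U · (U · pow U h)) (nat-two (suc h)) (nat-two c))) (λ _ → refl)))))

Y-base : ∀ c → Y 0 c ≈ nat c ⊕ X · Y 1 (2 ℕ.+ c)
Y-base c = ≈-trans (Yform-base (nat c))
  (⊕-cong {nat c} (λ _ → refl) (·-cong {X} (λ _ → refl)
    (≈-sym (Yform-cong (U · one) (nat-suc 1) (nat-two c)))))
  where
  Yform-base : ∀ c → Yform one one c ≈ c ⊕ X · Yform (U · one) (one ⊕ one) (two c)
  Yform-base c = by-relation c {C} {one ⊕ X · (U · C)} C-eq
    (≈-sym (by-relation (one ⊕ one) {D} {X · (U · C) ⊕ X · (U · D ⊕ U · D)} D-eq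
      (solve 5 (λ x u c′ d c →
        let one = con 1ℤ
            y p k c = c :* (c′ :* p) :+ (one :+ one) :* (k :* (p :* d)) in
        ((c :+ x :* y (u :* one) (one :+ one) (one :+ (one :+ c)))
          :+ c :* (c′ :- (one :+ x :* (u :* c′))))
          :+ (one :+ one) :* (d :- (x :* (u :* c′) :+ x :* (u :* d :+ u :* d)))
        := y one one c)
        (λ _ → refl) X U C D c)))

Y-children : ℕ → ℕ → Series
Y-children h c = Y (suc h) (2 ℕ.+ c) ⊕ ΣS h (λ i → Y (suc i) (2 ℕ.+ c) ⊕ Y i c)

-- Sums the differences `Y-step` back up from the boundary case h = 0.
Y-rec : ∀ h c → Y h c ≈ nat c ⊕ X · Y-children h c
Y-rec zero    c = ≈-trans (Y-base c) (⊕-cong {nat c} (λ _ → refl) (·-cong {X} (λ _ → refl)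
                    (λ n → sym (trans (cong (ℤ._+_ (Y 1 (2 ℕ.+ c) n)) (zero-const n)) (ℤₚ.+-identityʳ _)))))
Y-rec (suc h) c = ≈-trans (Y-step h c) (≈-trans (⊕-cong {h = X · (y₂ ⊕ y₀)} (Y-rec h c) (λ _ → refl))
  (≈-trans (solve 6 (λ x c y₁ s y₂ y₀ → (c :+ x :* (y₁ :+ s)) :+ x :* (y₂ :+ y₀)
                                     := c :+ x :* (y₂ :+ (s :+ (y₁ :+ y₀))))
              (λ _ → refl) X (nat c) y₁ s y₂ y₀)
  (⊕-cong {nat c} (λ _ → refl) (·-cong {X} (λ _ → refl) (⊕-cong {y₂} (λ _ → refl)
    (≈-sym (ΣS-last h (λ i → Y (suc i) (2 ℕ.+ c) ⊕ Y i c))))))))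
  where
  y₀ = Y h c
  y₁ = Y (suc h) (2 ℕ.+ c)
  y₂ = Y (suc (suc h)) (2 ℕ.+ c)
  s  = ΣS h (λ i → Y (suc i) (2 ℕ.+ c) ⊕ Y i c)

Σ<-ΣS : ∀ n h {f : ℕ → ℕ} {F : ℕ → Series} → (∀ i → + f i ≡ F i n) → + Σ< h f ≡ ΣS h F n
Σ<-ΣS zero    zero    eq = refl
Σ<-ΣS (suc n) zero    eq = refl
Σ<-ΣS n       (suc h) {f} eq = trans (ℤₚ.pos-+ (f 0) _) (cong₂ ℤ._+_ (eq 0) (Σ<-ΣS n h (eq ∘ suc)))

J≡Y : ∀ n h c → + J n h c ≡ Y h c n
J≡Y zero    h c = sym (trans (Y-rec h c 0) (ℤₚ.+-identityʳ (+ c)))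
J≡Y (suc n) h c = sym (begin
  Y h c (suc n)
    ≡⟨ Y-rec h c (suc n) ⟩
  0ℤ ℤ.+ (X · Y-children h c) (suc n)
    ≡⟨ trans (ℤₚ.+-identityˡ _) (X-· (Y-children h c) (suc n)) ⟩
  Y-children h c n
    ≡⟨ sym (cong₂ ℤ._+_ (J≡Y n (suc h) (2 ℕ.+ c)) (Σ<-ΣS n h {λ i → J n (suc i) (2 ℕ.+ c) ℕ.+ J n i c}
         (λ i → trans (ℤₚ.pos-+ (J n (suc i) (2 ℕ.+ c)) _) (cong₂ ℤ._+_ (J≡Y n (suc i) (2 ℕ.+ c)) (J≡Y n i c))))) ⟩
  + J n (suc h) (2 ℕ.+ c) ℤ.+ + Σ< h (λ i → J n (suc i) (2 ℕ.+ c) ℕ.+ J n i c)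
    ≡⟨ sym (ℤₚ.pos-+ (J n (suc h) (2 ℕ.+ c)) _) ⟩
  + J (suc n) h c ∎)
  where open ≡-Reasoning

-- The generating function of w

-- As U is a root of x u² - u + (1 + x), the series 1 - 2xU squares to the discriminant 1 - 4x (1 +
-- x).
sqrtSeries : Series
sqrtSeries = one -ˢ X · (U ⊕ U)

OnePlusW : Series
OnePlusW = poly (+ 1 ∷ []) ⊕ Wser

-- The empty chain gives `w 0` the value 1, so 1 + W is the generating function of `w` from index 0
-- on.
OnePlusW-coeff : ∀ n → OnePlusW n ≡ + w n
OnePlusW-coeff zero    = refl
OnePlusW-coeff (suc n) = ℤₚ.+-identityˡ _

OnePlusW-eq : OnePlusW ≈ one ⊕ X · (OnePlusW ⊕ (D ⊕ D))
OnePlusW-eq zero    = refl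
OnePlusW-eq (suc n) = begin
  OnePlusW (suc n)                     ≡⟨ OnePlusW-coeff (suc n) ⟩
  + w (suc n)                          ≡⟨ cong +_ (w-suc n) ⟩
  + (w n ℕ.+ J n 0 0)                  ≡⟨ ℤₚ.pos-+ (w n) _ ⟩
  + w n ℤ.+ + J n 0 0                  ≡⟨ cong₂ ℤ._+_ (sym (OnePlusW-coeff n)) (trans (J≡Y n 0 0) (Y00 n)) ⟩
  (OnePlusW ⊕ (D ⊕ D)) n               ≡⟨ sym (trans (ℤₚ.+-identityˡ _) (X-· (OnePlusW ⊕ (D ⊕ D)) (suc n))) ⟩
  0ℤ ℤ.+ (X · (OnePlusW ⊕ (D ⊕ D))) (suc n) ∎
  where
  open ≡-Reasoning
  Y00 : Y 0 0 ≈ D ⊕ D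
  Y00 = solve 2 (λ c d → con 0ℤ :* (c :* con 1ℤ) :+ (con 1ℤ :+ con 1ℤ) :* (con 1ℤ :* (con 1ℤ :* d)) := d :+ d)
          (λ _ → refl) C D

sqrt-square : sqrtSeries · sqrtSeries ≈ (one -ˢ nat 4 · X) -ˢ nat 4 · (X · X)
sqrt-square = by-relation (neg (nat 4) · X) {U} {(one ⊕ X) ⊕ X · (U · U)} U-eq
  (solve 2 (λ x u → let one = con 1ℤ ; four = con (+ 4) ; s = one :- x :* (u :+ u) in
     ((one :- four :* x) :- four :* (x :* x)) :+ ((Solver.:- four) :* x) :* (u :- ((one :+ x) :+ x :* (u :* u)))
     := s :* s)
   (λ _ → refl) X U)

-- Put s = 1 - 2xU. From (1 - x)(1 + W) = 1 + 2xD the left side is (1 + 2x(1 + x)D) s. Now sD = xUC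
-- and (1 + x)C = U turn it into s + 2x²U² = 1 - 2x(U - xU²), and U - xU² = 1 + x. The three
-- multipliers below are the factors of these steps.
W-sqrt : ((one -ˢ X · X) · OnePlusW -ˢ X) · sqrtSeries ≈ (one -ˢ nat 2 · X) -ˢ nat 2 · (X · X)
W-sqrt = by-relation ((one ⊕ X) · sqrtSeries) {OnePlusW} {one ⊕ X · (OnePlusW ⊕ (D ⊕ D))} OnePlusW-eq
  (≈-sym (by-relation (nat 2 · (X · (one ⊕ X))) {D} {X · (U · C) ⊕ X · (U · D ⊕ U · D)} D-eq
    (≈-sym (by-relation (nat 2 · X) {(one ⊕ X) ⊕ X · (U · U)} {U} (≈-sym U-eq)
      (solve 4 (λ x c d v →
        let one = con 1ℤ
            two = con (+ 2)
            u = (one :+ x) :* c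
            s = one :- x :* (u :+ u) in
        ((((one :- two :* x) :- two :* (x :* x))
          :+ ((one :+ x) :* s) :* (v :- (one :+ x :* (v :+ (d :+ d)))))
          :+ (two :* (x :* (one :+ x))) :* (d :- (x :* (u :* c) :+ x :* (u :* d :+ u :* d))))
          :+ (two :* x) :* (((one :+ x) :+ x :* (u :* u)) :- u)
        := ((one :- x :* x) :* v :- x) :* s)
        (λ _ → refl) X C D OnePlusW)))))

-- Translation to the polynomials and products of the statement

quadratic : ∀ a b → poly (+ 1 ∷ a ∷ b ∷ []) ≈ one ⊕ X · (const a ⊕ X · const b)
quadratic a b zero                = refl
quadratic a b (suc zero)          = sym (trans (ℤₚ.+-identityˡ _) (trans (X-· (const a ⊕ X · const b) 1) (ℤₚ.+-identityʳ a)))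
quadratic a b (suc (suc n))       = sym (trans (ℤₚ.+-identityˡ _) (trans (X-· (const a ⊕ X · const b) (suc (suc n)))
                                      (trans (ℤₚ.+-identityˡ _) (trans (X-· (const b) (suc n)) (const-poly n)))))
  where
  const-poly : ∀ n → const b n ≡ poly (b ∷ []) n
  const-poly zero    = refl
  const-poly (suc n) = refl

poly-X : poly (+ 0 ∷ + 1 ∷ []) ≈ X
poly-X zero          = refl
poly-X (suc zero)    = refl
poly-X (suc (suc n)) = refl

1-x² : poly (+ 1 ∷ + 0 ∷ -[1+ 0 ] ∷ []) ≈ one -ˢ X · X
1-x² = ≈-trans (quadratic (+ 0) -[1+ 0 ])
  (solve 1 (λ x → con 1ℤ :+ x :* (con 0ℤ :+ x :* con -[1+ 0 ]) := con 1ℤ :- x :* x) (λ _ → refl) X)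

1-2x-2x² : poly (+ 1 ∷ -[1+ 1 ] ∷ -[1+ 1 ] ∷ []) ≈ (one -ˢ nat 2 · X) -ˢ nat 2 · (X · X)
1-2x-2x² = ≈-trans (quadratic -[1+ 1 ] -[1+ 1 ])
  (solve 1 (λ x → con 1ℤ :+ x :* (con -[1+ 1 ] :+ x :* con -[1+ 1 ])
               := (con 1ℤ :- con (+ 2) :* x) :- con (+ 2) :* (x :* x)) (λ _ → refl) X)

1-4x-4x² : poly (+ 1 ∷ -[1+ 3 ] ∷ -[1+ 3 ] ∷ []) ≈ (one -ˢ nat 4 · X) -ˢ nat 4 · (X · X)
1-4x-4x² = ≈-trans (quadratic -[1+ 3 ] -[1+ 3 ])
  (solve 1 (λ x → con 1ℤ :+ x :* (con -[1+ 3 ] :+ x :* con -[1+ 3 ])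
               := (con 1ℤ :- con (+ 4) :* x) :- con (+ 4) :* (x :* x)) (λ _ → refl) X)

sumℤ : List ℤ → ℤ
sumℤ []      = 0ℤ
sumℤ (a ∷ l) = a ℤ.+ sumℤ l

sumℤ-unique : (s : List ℤ → ℤ) → s [] ≡ 0ℤ → (∀ a l → s (a ∷ l) ≡ a ℤ.+ s l) → ∀ l → s l ≡ sumℤ l
sumℤ-unique s nil cons []      = nil
sumℤ-unique s nil cons (a ∷ l) = trans (cons a l) (cong (ℤ._+_ a) (sumℤ-unique s nil cons l))

-- _⊛_ sums with a where-local function that has no name outside Defs; the
-- underscore stands for it, and is found by unification once its last argument is abstracted.
mutual
  localSum : Series → Series → ℕ → List ℤ → ℤ
  localSum = _

  ⊛-sumℤ : ∀ f h n → (f ⊛ h) n ≡ sumℤ (map (λ k → f k ℤ.* h (n ∸ k)) (upTo (suc n)))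
  ⊛-sumℤ f h n with map (λ k → f k ℤ.* h (n ∸ k)) (applyUpTo suc n)
  ... | l = cong (ℤ._+_ (f 0 ℤ.* h n)) (sumℤ-unique (localSum f h n) refl (λ _ _ → refl) l)

⊛≈· : ∀ f h → f ⊛ h ≈ f · h
⊛≈· f h n = trans (⊛-sumℤ f h n) (trans (cong sumℤ (map-upTo (λ k → f k ℤ.* h (n ∸ k)) (suc n))) (go f n))
  where
  go : ∀ f n → sumℤ (applyUpTo (λ k → f k ℤ.* h (n ∸ k)) (suc n)) ≡ (f · h) n
  go f zero    = ℤₚ.+-identityʳ _
  go f (suc n) = cong (ℤ._+_ (f 0 ℤ.* h (suc n))) (go (f ∘ suc) n)

-- The square root is a series S with constant term 1 and the prescribed square, and the identity is
-- cleared of its denominators by multiplying with (1 - x²) S.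
generatingFunction :
  Σ Series (λ S → (S 0 ≡ + 1)
    × ((n : ℕ) → (S ⊛ S) n ≡ poly (+ 1 ∷ -[1+ 3 ] ∷ -[1+ 3 ] ∷ []) n)
    × ((n : ℕ) → (((poly (+ 1 ∷ + 0 ∷ -[1+ 0 ] ∷ []) ⊛ (poly (+ 1 ∷ []) ⊕ Wser))
                    ⊖ poly (+ 0 ∷ + 1 ∷ [])) ⊛ S) n
                  ≡ poly (+ 1 ∷ -[1+ 1 ] ∷ -[1+ 1 ] ∷ []) n))
generatingFunction = sqrtSeries , refl
  , ≈-trans (⊛≈· sqrtSeries sqrtSeries) (≈-trans sqrt-square (≈-sym 1-4x-4x²))
  , ≈-trans (⊛≈· ((poly (+ 1 ∷ + 0 ∷ -[1+ 0 ] ∷ []) ⊛ OnePlusW) ⊖ poly (+ 0 ∷ + 1 ∷ [])) sqrtSeries)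
    (≈-trans (·-cong {h = sqrtSeries} (λ n → cong₂ ℤ._-_
               (trans (⊛≈· (poly (+ 1 ∷ + 0 ∷ -[1+ 0 ] ∷ [])) OnePlusW n) (·-cong {h = OnePlusW} 1-x² (λ _ → refl) n))
               (poly-X n)) (λ _ → refl))
    (≈-trans W-sqrt (≈-sym 1-2x-2x²)))

theorem7 : ((n : ℕ) → n ≥ 1 → w n ≡ rhs n)
         × (w 1 ≡ 1 × w 2 ≡ 3 × w 3 ≡ 13 × w 4 ≡ 59 × w 5 ≡ 269 × w 6 ≡ 1227
            × w 7 ≡ 5613 × w 8 ≡ 25771 × w 9 ≡ 118765)
         × Σ Series (λ S → (S 0 ≡ + 1)
             × ((n : ℕ) → (S ⊛ S) n ≡ poly (+ 1 ∷ -[1+ 3 ] ∷ -[1+ 3 ] ∷ []) n)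
             × ((n : ℕ) → (((poly (+ 1 ∷ + 0 ∷ -[1+ 0 ] ∷ []) ⊛ (poly (+ 1 ∷ []) ⊕ Wser))
                             ⊖ poly (+ 0 ∷ + 1 ∷ [])) ⊛ S) n
                           ≡ poly (+ 1 ∷ -[1+ 1 ] ∷ -[1+ 1 ] ∷ []) n))
theorem7 = w≡rhs
  , (w≡ΣJ 1 , w≡ΣJ 2 , w≡ΣJ 3 , w≡ΣJ 4 , w≡ΣJ 5 , w≡ΣJ 6 , w≡ΣJ 7 , w≡ΣJ 8 , w≡ΣJ 9)
  , generatingFunction
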